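{- For any finite graph $G$ and any $\varepsilon>0$, the convexity space $\mathcal{C}(G)$ has weak $\varepsilon$-nets of size at most $(480/\varepsilon)^{8\nu_{\mathrm{bi}}(G)\log(1/\varepsilon)}$. In other words, for any set system $\mathcal{G}\subseteq\mathcal{C}(G)$, $$\tau(\mathcal{G})\le (480\,\tau^*(\mathcal{G}))^{8\nu_{\mathrm{bi}}(G)\log\tau^*(\mathcal{G})}.$$
   Context: Let $X=\mathrm{MIS}(G)$ be the set of maximal independent sets of $G$; for $S\subseteq V(G)$ let $K_S=\{I\in X: S\subseteq I\}$; $\mathcal{C}(G)=\{K_S: S\subseteq V(G)\}$. Given a finitely supported probability measure $\mu$ on $X$, a set $N\subseteq X$ is a weak $\varepsilon$-net for $\mathcal{C}(G)$ with respect to $\mu$ if $N\cap C\ne\emptyset$ for every $C\in\mathcal{C}(G)$ with $\mu(C)\ge\varepsilon$; $\mathcal{C}(G)$ has weak $\varepsilon$-nets of size $m$ if for every finitely supported probability measure $\mu$ on $X$ there is such a net of size at most $m$. $\tau(\mathcal{G})$ is the minimum size of a set $T\subseteq X$ meeting every member of $\mathcal{G}$; $\tau^*(\mathcal{G})$ is the minimum of $\sum_{x\in X}f(x)$ over functions $f:X\to[0,1]$ with $\sum_{x\in A}f(x)\ge1$ for all $A\in\mathcal{G}$. $\nu_{\mathrm{bi}}(G)$ is the largest $t$ such that $G$ has $2t$ distinct vertices $u_1,\dots,u_t,v_1,\dots,v_t$ with $u_iv_j\in E(G)$ iff $i=j$. Logarithms are natural. -}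

module Defs where

open import Level using (0ℓ) renaming (suc to lsuc)
open import Algebra.Bundles using (CommutativeRing)
import Algebra.Definitions.RawMonoid as RawMonoidDefs
open import Data.Bool.Base using (Bool; true; if_then_else_)
open import Data.Fin.Base using (Fin)
open import Data.Fin.Properties using (all?)
open import Data.Fin.Subset using (Subset; _∈_; _⊆_; inside; outside)
open import Data.Fin.Subset.Properties using (_∈?_; _⊆?_; anySubset?)
open import Data.List.Base using (List; []; _∷_; map; _++_; mapMaybe; foldr; length; filterᵇ)
open import Data.Maybe.Base using (Maybe; just; nothing)
open import Data.Nat.Base as ℕ using (ℕ; zero; suc)
open import Data.Product.Base using (∃; _×_; _,_)
open import Data.Vec.Base using ([]; _∷_)
open import Function.Base using (_∘_)
open import Function.Bundles using (_⇔_)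
open import Function.Definitions using (Injective)
open import Relation.Binary.Core using (Rel)
open import Relation.Binary.Definitions using (Decidable; Symmetric; Irreflexive)
open import Relation.Binary.PropositionalEquality using (_≡_; _≢_)
open import Relation.Binary.Structures using (IsDecTotalOrder)
open import Relation.Nullary.Decidable using (Dec; yes; no; does; ¬?; _×-dec_; _→-dec_; map′; decidable-stable)
open import Relation.Nullary.Negation using (¬_)
open import Relation.Unary using (Pred)

------------------------------------------------------------------------
-- Real numbers

-- Axioms of a complete ordered field, which characterise ℝ up to unique
-- isomorphism.  Equality is a setoid equality; the order is decidable, as it
-- is classically.  The value of 0# ⁻¹ is unconstrained.

record CompleteOrderedField : Set (lsuc 0ℓ) where
  infix  8 _⁻¹
  infix  4 _≤_ _<_
  field
    commutativeRing : CommutativeRing 0ℓ 0ℓ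

  open CommutativeRing commutativeRing public
    renaming (Carrier to ℝ)

  field
    _≤_             : Rel ℝ 0ℓ
    isDecTotalOrder : IsDecTotalOrder _≈_ _≤_
    0≉1             : ¬ (0# ≈ 1#)
    _⁻¹             : ℝ → ℝ
    ⁻¹-inverseʳ     : ∀ x → ¬ (x ≈ 0#) → x * x ⁻¹ ≈ 1#
    +-monoˡ-≤       : ∀ z {x y} → x ≤ y → x + z ≤ y + z
    *-nonNeg        : ∀ {x y} → 0# ≤ x → 0# ≤ y → 0# ≤ x * y

  _<_ : Rel ℝ 0ℓ
  x < y = x ≤ y × ¬ (x ≈ y)

  IsUpperBound : Pred ℝ 0ℓ → ℝ → Set
  IsUpperBound P b = ∀ x → P x → x ≤ b

  field
    complete : (P : Pred ℝ 0ℓ) → ∃ P → ∃ (IsUpperBound P) →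
               ∃ λ s → IsUpperBound P s × (∀ b → IsUpperBound P b → s ≤ b)

  open RawMonoidDefs +-rawMonoid public using () renaming (_×_ to _·_)

  fromℕ : ℕ → ℝ
  fromℕ n = n · 1#

  sumOver : {A : Set} → List A → (A → ℝ) → ℝ
  sumOver xs f = foldr (λ x s → f x + s) 0# xs

-- The exponential is the only function on ℝ satisfying exp-+ and 1+x≤exp:
-- together they force exp to be its own derivative with exp 0 = 1.  The natural
-- logarithm is its inverse on the positive reals, unconstrained elsewhere.

record NaturalExpLog (R : CompleteOrderedField) : Set where
  open CompleteOrderedField R
  infixr 9 _^ʳ_
  field
    exp      : ℝ → ℝ
    exp-cong : ∀ {x y} → x ≈ y → exp x ≈ exp y
    exp-+    : ∀ x y → exp (x + y) ≈ exp x * exp y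
    1+x≤exp  : ∀ x → 1# + x ≤ exp x
    log      : ℝ → ℝ
    exp-log  : ∀ x → 0# < x → exp (log x) ≈ x

  -- The real power, for positive base.
  _^ʳ_ : ℝ → ℝ → ℝ
  a ^ʳ b = exp (b * log a)

------------------------------------------------------------------------
-- Graphs and maximal independent sets

record Graph (n : ℕ) : Set₁ where
  field
    Adj    : Rel (Fin n) 0ℓ
    adj?   : Decidable Adj
    sym    : Symmetric Adj
    irrefl : Irreflexive _≡_ Adj

IsMaximum : Pred ℕ 0ℓ → Pred ℕ 0ℓ
IsMaximum P m = P m × (∀ k → P k → k ℕ.≤ m)

module _ {n : ℕ} (G : Graph n) where
  open Graph G

  IsIndependent : Pred (Subset n) 0ℓ
  IsIndependent S = ∀ u v → u ∈ S → v ∈ S → ¬ Adj u v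

  IsMaximalIndependent : Pred (Subset n) 0ℓ
  IsMaximalIndependent S =
    IsIndependent S × (∀ S′ → IsIndependent S′ → S ⊆ S′ → S′ ⊆ S)

  isIndependent? : ∀ S → Dec (IsIndependent S)
  isIndependent? S = all? λ u → all? λ v →
    (u ∈? S) →-dec ((v ∈? S) →-dec ¬? (adj? u v))

  isMaximalIndependent? : ∀ S → Dec (IsMaximalIndependent S)
  isMaximalIndependent? S = isIndependent? S ×-dec maximal?
    where
    Larger : Pred (Subset n) 0ℓ
    Larger S′ = IsIndependent S′ → S ⊆ S′ → S′ ⊆ S
    larger? : ∀ S′ → Dec (Larger S′)
    larger? S′ = isIndependent? S′ →-dec ((S ⊆? S′) →-dec (S′ ⊆? S))
    maximal? : Dec (∀ S′ → Larger S′)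
    maximal? = map′
      (λ ¬∃ S′ → decidable-stable (larger? S′) (λ ¬l → ¬∃ (S′ , ¬l)))
      (λ { all (S′ , ¬l) → ¬l (all S′) })
      (¬? (anySubset? (¬? ∘ larger?)))

  -- The set X.  The proof is irrelevant, so that equality of elements of X is
  -- equality of the underlying vertex sets.
  record MIS : Set where
    constructor mis
    field
      vertices : Subset n
      .isMaximalIndependent : IsMaximalIndependent vertices

  IsInducedBimatching : (t : ℕ) → (u v : Fin t → Fin n) → Set
  IsInducedBimatching t u v =
    Injective _≡_ _≡_ u × Injective _≡_ _≡_ v × (∀ i j → u i ≢ v j) ×
    (∀ i j → Adj (u i) (v j) ⇔ i ≡ j)

  Isν-bi : ℕ → Set
  Isν-bi = IsMaximum λ t → ∃ λ u → ∃ λ v → IsInducedBimatching t u v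

allSubsets : (n : ℕ) → List (Subset n)
allSubsets zero    = [] ∷ []
allSubsets (suc n) = map (outside ∷_) (allSubsets n) ++ map (inside ∷_) (allSubsets n)

-- Every element of X, listed exactly once.
allMIS : ∀ {n} (G : Graph n) → List (MIS G)
allMIS {n} G = mapMaybe toMIS (allSubsets n)
  where
  toMIS : Subset n → Maybe (MIS G)
  toMIS S with isMaximalIndependent? G S
  ... | yes p = just (mis S p)
  ... | no  _ = nothing

------------------------------------------------------------------------
-- Subsets of X, given by their indicator functions, and the convexity space

module _ {n : ℕ} (G : Graph n) where

  SetOfMIS : Set
  SetOfMIS = MIS G → Bool

  SetSystem : Set₁
  SetSystem = Pred SetOfMIS 0ℓ

  card : SetOfMIS → ℕ
  card A = length (filterᵇ A (allMIS G))

  Meets : SetOfMIS → SetOfMIS → Set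
  Meets N A = ∃ λ I → N I ≡ true × A I ≡ true

  K : Subset n → SetOfMIS
  K S I = does (S ⊆? MIS.vertices I)

  𝒞 : SetSystem
  𝒞 A = ∃ λ S → ∀ I → A I ≡ K S I

  Transversal : SetSystem → SetOfMIS → Set
  Transversal 𝒢 T = ∀ A → 𝒢 A → Meets T A

  -- IsTau 𝒢 t says that τ(𝒢) exists and equals t.
  IsTau : SetSystem → ℕ → Set
  IsTau 𝒢 t = (∃ λ T → Transversal 𝒢 T × card T ≡ t)
            × (∀ T → Transversal 𝒢 T → t ℕ.≤ card T)

module _ (R : CompleteOrderedField) {n : ℕ} (G : Graph n) where
  open CompleteOrderedField R

  sumOn : SetOfMIS G → (MIS G → ℝ) → ℝ
  sumOn A f = sumOver (allMIS G) λ I → if A I then f I else 0#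

  total : (MIS G → ℝ) → ℝ
  total = sumOver (allMIS G)

  -- As X is finite, every measure on it is finitely supported.
  record ProbabilityMeasure : Set where
    field
      weight        : MIS G → ℝ
      weight-nonNeg : ∀ I → 0# ≤ weight I
      weight-total  : total weight ≈ 1#

    measure : SetOfMIS G → ℝ
    measure A = sumOn A weight

  IsWeakNet : ℝ → ProbabilityMeasure → SetOfMIS G → Set
  IsWeakNet ε μ N = ∀ C → 𝒞 G C → ε ≤ ProbabilityMeasure.measure μ C → Meets G N C

  HasWeakNetsOfSize≤ : ℝ → ℝ → Set
  HasWeakNetsOfSize≤ ε b =
    ∀ μ → ∃ λ N → IsWeakNet ε μ N × fromℕ (card G N) ≤ b

  FractionalTransversal : SetSystem G → (MIS G → ℝ) → Set
  FractionalTransversal 𝒢 f =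
    (∀ I → 0# ≤ f I × f I ≤ 1#) × (∀ A → 𝒢 A → 1# ≤ sumOn A f)

  -- IsTau* 𝒢 s says that τ*(𝒢) exists and equals s.
  IsTau* : SetSystem G → ℝ → Set
  IsTau* 𝒢 s = (∃ λ f → FractionalTransversal 𝒢 f × total f ≈ s)
             × (∀ f → FractionalTransversal 𝒢 f → s ≤ total f)

{-# OPTIONS --safe #-}

-- Two facts about maximal independent sets carry the argument.
--
-- Centers: vertices v whose K_v has more than half of the measure of K_S are pairwise
-- non-adjacent, so some maximal independent set, the center of S, contains them all.  If it
-- lies outside K_T, then K_T misses at least half of K_S.  Hence the centers of a maximal
-- sequence of sets K_S of measure at least ε, each missing half of every earlier one, form
-- a weak ε-net, and it remains to bound the length m of such a sequence.
--
-- Hulls: if no member of a family of d ≥ 3 maximal independent sets contains the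
-- intersection of the others, then vertices witnessing this and suitable neighbours of
-- theirs form an induced bimatching, so d ≤ ν.  Hence the trace of a set K_S on k points is
-- determined by at most 2ν of them, and there are at most q^(2ν) (1 + 1/q)^k traces for any
-- q ≥ 1.
--
-- A point separates each pair of the sequence with probability at least ε/2, so greedily
-- chosen points make all traces distinct with k about (4/ε) log m.  For q of order 1/ε the
-- factor (1 + 1/q)^k is of order √m, whence m ≤ (C/ε)^(4ν).  For ε ≤ 1/2 this is within the
-- claimed bound, because log (1/ε) ≥ 1/2; for ε > 1/2 the center of ∅ alone is a net.
module Submission where

open import Defs
open import Level using (0ℓ)
open import Data.Bool.Base using (Bool; true; false; if_then_else_; T)
import Data.Bool.Properties as Bool
open import Data.Fin.Base using (Fin; zero; suc)
open import Data.Fin.Properties as Fin using (all?; any?)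
open import Data.Fin.Subset using (Subset; _∈_; _∉_; _⊆_; _∪_; ⊥; ⁅_⁆; ∣_∣; inside; outside)
open import Data.Fin.Subset.Properties
  using (_∈?_; _⊆?_; anySubset?; p⊆p∪q; q⊆p∪q; x∈p∪q⁻; x∈⁅x⁆; x∈⁅y⁆⇒x≡y; ∣p∣≤n; p─q⊆p
        ; x∈p∧x≢y⇒x∈p-y; x∈p⇒∣p-x∣<∣p∣; p⊂q⇒∣p∣<∣q∣; ⊆-min)
open import Data.List.Base as List using (List; []; _∷_; map; _++_; length; filter; mapMaybe)
open import Data.List.Properties using (length-map; length-++; map-++; map-∘)
import Data.List.Membership.Propositional as L
open import Data.List.Membership.Propositional using (find)
open import Data.List.Membership.Propositional.Properties
  using (∈-∃++; ∈-++⁺ˡ; ∈-++⁺ʳ; ∈-++⁻; ∈-map⁺; ∈-map⁻; ∈-filter⁺)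
open import Data.List.Relation.Binary.Disjoint.Propositional using (Disjoint)
open import Data.List.Relation.Unary.All as All using (All; []; _∷_)
import Data.List.Relation.Unary.All.Properties as All
open import Data.List.Relation.Unary.AllPairs as AllPairs using (AllPairs; []; _∷_)
import Data.List.Relation.Unary.AllPairs.Properties as AllPairs
open import Data.List.Relation.Unary.Any as Any using (Any; here; there; index)
open import Data.List.Relation.Unary.Any.Properties using (lookup-index)
open import Data.List.Relation.Unary.Unique.Propositional using (Unique)
import Data.List.Relation.Unary.Unique.Propositional.Properties as Unique
open import Data.Maybe.Base using (Maybe; just; nothing)
open import Data.Nat.Base as ℕ using (ℕ; zero; suc; z≤n; s≤s; NonZero)
open import Data.Nat.Induction using (<-wellFounded)
open import Data.Nat.ListAction using (sum)
open import Data.Nat.ListAction.Properties using (sum-++)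
import Data.Nat.Properties as ℕ
open import Data.Nat.Solver using (module +-*-Solver)
open import Data.Nat.Tactic.RingSolver using (solve-∀)
open import Data.Product.Base using (∃; ∃₂; _×_; _,_; proj₁; proj₂; uncurry)
open import Data.Sum.Base using (_⊎_; inj₁; inj₂)
open import Data.Vec.Base using ([]; _∷_; here; there; tabulate)
open import Data.Vec.Properties
  using (lookup∘tabulate; lookup⇒[]=; []=⇒lookup; ∷-injectiveʳ; ≡-dec)
open import Function.Base using (_∘_)
open import Function.Bundles using (mk⇔)
open import Function.Definitions using (Injective)
open import Induction.WellFounded using (Acc; acc)
open import Relation.Binary.Bundles using (Poset)
open import Relation.Binary.Core using (Rel)
open import Relation.Binary.PropositionalEquality as ≡ using (_≡_; _≢_)
open import Relation.Binary.Structures using (IsDecTotalOrder)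
open import Relation.Nullary.Decidable
  using (Dec; yes; no; does; ¬?; _×-dec_; _→-dec_; recompute; decidable-stable; dec-true; T?)
open import Relation.Nullary.Negation using (¬_; contradiction)
open import Relation.Unary as Unary using (Pred; Decidable)
import Algebra.Properties.CommutativeMonoid.Mult as CommutativeMonoidMult
import Algebra.Properties.CommutativeSemigroup as CommutativeSemigroupProperties
import Algebra.Properties.Ring as RingProperties
import Algebra.Properties.Semiring.Mult as SemiringMult
import Relation.Binary.Reasoning.PartialOrder as PartialOrderReasoning

module Combinatorics where
  open import Data.Fin.Subset using (_-_)
  open import Data.Nat.Base using (_+_; _*_; _∸_; _^_; _≤_; _<_)
  open import Data.Nat.Properties hiding (_≟_)
  open import Relation.Binary.PropositionalEquality
  open +-*-Solver using (solve; _:+_; _:*_; _:^_; _:=_; con)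

  -- Subsets of a finite set

  subset : ∀ {n} {P : Pred (Fin n) 0ℓ} → Decidable P → Subset n
  subset P? = tabulate (does ∘ P?)

  ∈-subset⁺ : ∀ {n} {P : Pred (Fin n) 0ℓ} (P? : Decidable P) {v} → P v → v ∈ subset P?
  ∈-subset⁺ P? {v} p =
    lookup⇒[]= v _ (trans (lookup∘tabulate (does ∘ P?) v) (dec-true (P? v) p))

  ∈-subset⁻ : ∀ {n} {P : Pred (Fin n) 0ℓ} (P? : Decidable P) {v} → v ∈ subset P? → P v
  ∈-subset⁻ P? {v} v∈ with P? v | trans (sym (lookup∘tabulate (does ∘ P?) v)) ([]=⇒lookup v∈)
  ... | yes p | _ = p
  ... | no _ | ()

  ⊈⇒∃ : ∀ {n} {S T : Subset n} → ¬ (S ⊆ T) → ∃ λ v → v ∈ S × v ∉ T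
  ⊈⇒∃ {S = S} {T} S⊈T with any? (λ v → (v ∈? S) ×-dec ¬? (v ∈? T))
  ... | yes found = found
  ... | no ¬found = contradiction
    (λ {v} v∈S → decidable-stable (v ∈? T) (λ v∉T → ¬found (v , v∈S , v∉T))) S⊈T

  element : ∀ {k} (S : Subset k) → Fin ∣ S ∣ → Fin k
  element (inside  ∷ S) zero    = zero
  element (inside  ∷ S) (suc i) = suc (element S i)
  element (outside ∷ S) i       = suc (element S i)

  element-∈ : ∀ {k} (S : Subset k) i → element S i ∈ S
  element-∈ (inside  ∷ S) zero    = here
  element-∈ (inside  ∷ S) (suc i) = there (element-∈ S i)
  element-∈ (outside ∷ S) i       = there (element-∈ S i)

  element-injective : ∀ {k} (S : Subset k) → Injective _≡_ _≡_ (element S)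
  element-injective (inside  ∷ S) {zero}  {zero}  _  = refl
  element-injective (inside  ∷ S) {suc i} {suc j} eq =
    cong suc (element-injective S (Fin.suc-injective eq))
  element-injective (outside ∷ S) eq = element-injective S (Fin.suc-injective eq)

  -- Hulls and irredundant families

  -- The hull of the points x g, g ∈ T, is the set K_S for S the set of all v with InHull T v.
  module _ {k n : ℕ} (x : Fin k → Subset n) where

    InHull : Subset k → Fin n → Set
    InHull T v = ∀ g → g ∈ T → v ∈ x g

    -- In the convexity space, `x g` lies in the convex hull of the other points of `T`;
    -- `Irredundant` is thus convex independence.
    Redundant : Subset k → Fin k → Set
    Redundant T g = ∀ v → (∀ h → h ∈ T → h ≢ g → v ∈ x h) → v ∈ x g

    redundant? : ∀ T g → Dec (Redundant T g)
    redundant? T g = all? λ v →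
      (all? λ h → (h ∈? T) →-dec (¬? (h Fin.≟ g) →-dec (v ∈? x h))) →-dec (v ∈? x g)

    Irredundant : Subset k → Set
    Irredundant T = ∀ g → g ∈ T → ¬ Redundant T g

    -- Deleting a redundant point leaves the hull unchanged and decreases the cardinality, so
    -- repeated deletion ends in an irredundant family.
    irredundant-core : ∀ T →
      ∃ λ G → G ⊆ T × Irredundant G × (∀ {v} → InHull G v → InHull T v)
    irredundant-core T = go T (<-wellFounded ∣ T ∣)
      where
      go : ∀ T → Acc ℕ._<_ ∣ T ∣ →
           ∃ λ G → G ⊆ T × Irredundant G × (∀ {v} → InHull G v → InHull T v)
      go T (acc rec) with any? (λ g → (g ∈? T) ×-dec redundant? T g)
      ... | no ¬red = T , (λ h → h) , (λ g g∈T r → ¬red (g , g∈T , r)) , λ h → h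
      ... | yes (g , g∈T , red) with go (T - g) (rec (x∈p⇒∣p-x∣<∣p∣ g∈T))
      ...   | G , G⊆ , irr , hull = G , (λ h → p─q⊆p T ⁅ g ⁆ (G⊆ h)) , irr , hull′
        where
        hull′ : ∀ {v} → InHull G v → InHull T v
        hull′ {v} vG h h∈T with h Fin.≟ g
        ... | no h≢g   = hull vG h (x∈p∧x≢y⇒x∈p-y h∈T h≢g)
        ... | yes refl = red v λ h′ h′∈T h′≢g → hull vG h′ (x∈p∧x≢y⇒x∈p-y h′∈T h′≢g)

    irredundant⇒witness : ∀ {T} → Irredundant T → ∀ g → g ∈ T →
      ∃ λ v → (∀ h → h ∈ T → h ≢ g → v ∈ x h) × v ∉ x g
    irredundant⇒witness {T} irr g g∈T with any? (λ v →
      (all? λ h → (h ∈? T) →-dec (¬? (h Fin.≟ g) →-dec (v ∈? x h))) ×-dec ¬? (v ∈? x g))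
    ... | yes w = w
    ... | no ¬w = contradiction
      (λ v all → decidable-stable (v ∈? x g) λ v∉ → ¬w (v , all , v∉)) (irr g g∈T)

  -- Maximal independent sets and induced bimatchings

  avoid-two : ∀ {t} (i j : Fin (3 ℕ.+ t)) → ∃ λ k → i ≢ k × j ≢ k
  avoid-two zero          zero          = suc zero , (λ ()) , λ ()
  avoid-two zero          (suc zero)    = suc (suc zero) , (λ ()) , λ ()
  avoid-two zero          (suc (suc _)) = suc zero , (λ ()) , λ ()
  avoid-two (suc _)       (suc _)       = zero , (λ ()) , λ ()
  avoid-two (suc zero)    zero          = suc (suc zero) , (λ ()) , λ ()
  avoid-two (suc (suc _)) zero          = suc zero , (λ ()) , λ ()

  module _ {n : ℕ} (G : Graph n) where
    open Graph G using (Adj; adj?; irrefl) renaming (sym to Adj-sym)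
    open MIS

    -- The proof stored in an element of `MIS` is irrelevant; decidability allows recomputing it as
    -- a relevant one.
    maximalIndependent : (I : MIS G) → IsMaximalIndependent G (vertices I)
    maximalIndependent (mis S p) = recompute (isMaximalIndependent? G S) p

    ∪-singleton-independent : ∀ {S v} → IsIndependent G S → (∀ u → u ∈ S → ¬ Adj u v) →
                              IsIndependent G (S ∪ ⁅ v ⁆)
    ∪-singleton-independent {S} {v} ind ¬adj a b a∈ b∈
      with x∈p∪q⁻ S ⁅ v ⁆ a∈ | x∈p∪q⁻ S ⁅ v ⁆ b∈
    ... | inj₁ a∈S | inj₁ b∈S = ind a b a∈S b∈S
    ... | inj₁ a∈S | inj₂ b∈v rewrite x∈⁅y⁆⇒x≡y v b∈v = ¬adj a a∈S
    ... | inj₂ a∈v | inj₁ b∈S rewrite x∈⁅y⁆⇒x≡y v a∈v = ¬adj b b∈S ∘ Adj-sym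
    ... | inj₂ a∈v | inj₂ b∈v rewrite x∈⁅y⁆⇒x≡y v a∈v | x∈⁅y⁆⇒x≡y v b∈v = irrefl {v} refl

    -- Otherwise adding `v` to `I` would give a larger independent set, against maximality.
    neighbour : (I : MIS G) → ∀ {v} → v ∉ vertices I → ∃ λ u → u ∈ vertices I × Adj u v
    neighbour I {v} v∉I with any? (λ u → (u ∈? vertices I) ×-dec adj? u v)
    ... | yes found = found
    ... | no ¬found = contradiction (max _ ind′ (p⊆p∪q ⁅ v ⁆) (q⊆p∪q _ ⁅ v ⁆ (x∈⁅x⁆ v))) v∉I
      where
      ind = proj₁ (maximalIndependent I)
      max = proj₂ (maximalIndependent I)
      ind′ = ∪-singleton-independent ind λ u u∈I a → ¬found (u , u∈I , a)

    -- Recursion on the number of vertices outside `S`: pass to a strictly larger independent set as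
    -- long as there is one.
    extend : ∀ S → IsIndependent G S → ∃ λ (I : MIS G) → S ⊆ vertices I
    extend S = go S (<-wellFounded (n ∸ ∣ S ∣))
      where
      go : ∀ S → Acc ℕ._<_ (n ∸ ∣ S ∣) → IsIndependent G S → ∃ λ (I : MIS G) → S ⊆ vertices I
      go S (acc rec) ind
        with anySubset? (λ S′ → isIndependent? G S′ ×-dec ((S ⊆? S′) ×-dec ¬? (S′ ⊆? S)))
      ... | no ¬larger = mis S (ind , max) , λ h → h
        where
        max : ∀ S′ → IsIndependent G S′ → S ⊆ S′ → S′ ⊆ S
        max S′ ind′ S⊆S′ =
          decidable-stable (S′ ⊆? S) λ S′⊈S → ¬larger (S′ , ind′ , S⊆S′ , S′⊈S)
      ... | yes (S′ , ind′ , S⊆S′ , S′⊈S)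
        with go S′ (rec (∸-monoʳ-< (p⊂q⇒∣p∣<∣q∣ (S⊆S′ , ⊈⇒∃ S′⊈S)) (∣p∣≤n S′))) ind′
      ...   | I , S′⊆I = I , λ h → S′⊆I (S⊆S′ h)

    -- Take for `u i` a neighbour of `v i` inside `x i`. For `i ≢ j` both `u i` and `v j` lie in the
    -- independent set `x i`, so they are not adjacent; injectivity of `u` and `v` follows from
    -- this.
    irredundant⇒bimatching : ∀ {t} (x : Fin (3 ℕ.+ t) → MIS G) (v : Fin (3 ℕ.+ t) → Fin n) →
      (∀ i j → i ≢ j → v i ∈ vertices (x j)) → (∀ i → v i ∉ vertices (x i)) →
      ∃₂ (IsInducedBimatching G (3 ℕ.+ t))
    irredundant⇒bimatching x v v∈x v∉x = u , v , u-injective , v-injective , u≢v , u~v⇔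
      where
      u : _ → Fin n
      u i = proj₁ (neighbour (x i) (v∉x i))
      u∈x : ∀ i → u i ∈ vertices (x i)
      u∈x i = proj₁ (proj₂ (neighbour (x i) (v∉x i)))
      u~v : ∀ i → Adj (u i) (v i)
      u~v i = proj₂ (proj₂ (neighbour (x i) (v∉x i)))
      independent : ∀ i → IsIndependent G (vertices (x i))
      independent i = proj₁ (maximalIndependent (x i))
      u~v⇒≡ : ∀ i j → Adj (u i) (v j) → i ≡ j
      u~v⇒≡ i j a = decidable-stable (i Fin.≟ j) λ i≢j →
        independent i _ _ (u∈x i) (v∈x j i (i≢j ∘ sym)) a
      u~v⇔ : ∀ i j → _
      u~v⇔ i j = mk⇔ (u~v⇒≡ i j) λ { refl → u~v i }
      u-injective : Injective _≡_ _≡_ u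
      u-injective {i} {j} eq = u~v⇒≡ i j (subst (λ w → Adj w (v j)) (sym eq) (u~v j))
      v-injective : Injective _≡_ _≡_ v
      v-injective {i} {j} eq = u~v⇒≡ i j (subst (Adj (u i)) eq (u~v i))
      u≢v : ∀ i j → u i ≢ v j
      -- If `u i` were `v j`, then `v j` and `v i` would be adjacent inside `x k`. The third index
      -- `k` is why at least three points are required.
      u≢v i j eq with avoid-two i j
      ... | k , i≢k , j≢k =
        independent k _ _ (v∈x j k j≢k) (v∈x i k i≢k) (subst (λ w → Adj w (v i)) eq (u~v i))

    edge⇒bimatching : ∀ {u v} → Adj u v → ∃₂ (IsInducedBimatching G 1)
    edge⇒bimatching {u} {v} a = (λ _ → u) , (λ _ → v) ,
      (λ { {zero} {zero} _ → refl }) , (λ { {zero} {zero} _ → refl }) ,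
      (λ _ _ u≡v → irrefl u≡v a) , λ { zero zero → mk⇔ (λ _ → refl) (λ _ → a) }

    -- Three or more irredundant points give a bimatching, so then `∣ T ∣ ≤ ν`. The factor 2 absorbs
    -- the sizes 1 and 2, where a third index is missing but `1 ≤ ν` helps.
    irredundant-bound : ∀ {ν} → Isν-bi G ν → 1 ℕ.≤ ν → ∀ {k} (x : Fin k → MIS G) {T} →
      Irredundant (vertices ∘ x) T → ∣ T ∣ ℕ.≤ 2 ℕ.* ν
    irredundant-bound {ν} (_ , max) 1≤ν x {T} irr
      with ∣ T ∣ in eq | element T | element-∈ T | element-injective T
    ... | 0 | _ | _ | _ = z≤n
    ... | 1 | _ | _ | _ = ℕ.≤-trans 1≤ν (ℕ.m≤m+n ν _)
    ... | 2 | _ | _ | _ = ℕ.*-monoʳ-≤ 2 1≤ν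
    ... | suc (suc (suc t)) | e | e∈ | e-inj = ℕ.≤-trans (max _ bimatching) (ℕ.m≤m+n ν _)
      where
      w : ∀ i → _
      w i = irredundant⇒witness (vertices ∘ x) irr (e i) (e∈ i)
      bimatching = irredundant⇒bimatching (x ∘ e) (proj₁ ∘ w)
        (λ i j i≢j → proj₁ (proj₂ (w i)) (e j) (e∈ j) (i≢j ∘ sym ∘ e-inj))
        (λ i → proj₂ (proj₂ (w i)))

  -- Lists without repetition and the enumeration of X

  T-does⁻ : ∀ {P : Set} (P? : Dec P) → T (does P?) → P
  T-does⁻ (yes p) _ = p

  -- Induction on `xs`, deleting from `ys` one occurrence of the head; the tail survives the
  -- deletion because `xs` has no repetitions.
  sum-map-≤ : ∀ {A : Set} (f : A → ℕ) {xs ys} → Unique xs → All (L._∈ ys) xs →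
              sum (map f xs) ≤ sum (map f ys)
  sum-map-≤ f [] [] = z≤n
  sum-map-≤ f {x ∷ xs} (x∉xs ∷ uniq) (x∈ys ∷ xs⊆ys) with ∈-∃++ x∈ys
  ... | as , bs , refl = begin
    f x + sum (map f xs)                        ≤⟨ +-monoʳ-≤ (f x) (sum-map-≤ f uniq xs⊆as++bs) ⟩
    f x + sum (map f (as ++ bs))                ≡⟨ cong (f x +_) (sum-map-++ as bs) ⟩
    f x + (sum (map f as) + sum (map f bs))     ≡⟨ +-assoc-middle (f x) (sum (map f as)) _ ⟩
    sum (map f as) + (f x + sum (map f bs))     ≡⟨ sum-map-++ as (x ∷ bs) ⟨
    sum (map f (as ++ x ∷ bs))                  ∎
    where
    open ≤-Reasoning
    +-assoc-middle : ∀ a b c → a + (b + c) ≡ b + (a + c)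
    +-assoc-middle = solve-∀
    sum-map-++ : ∀ as bs → sum (map f (as ++ bs)) ≡ sum (map f as) + sum (map f bs)
    sum-map-++ as bs = trans (cong sum (map-++ f as bs)) (sum-++ (map f as) (map f bs))
    drop-x : ∀ {y} → x ≢ y → y L.∈ as ++ x ∷ bs → y L.∈ as ++ bs
    drop-x x≢y y∈ with ∈-++⁻ as y∈
    ... | inj₁ y∈as             = ∈-++⁺ˡ y∈as
    ... | inj₂ (here y≡x)       = contradiction (sym y≡x) x≢y
    ... | inj₂ (there y∈bs)     = ∈-++⁺ʳ as y∈bs
    xs⊆as++bs : All (L._∈ as ++ bs) xs
    xs⊆as++bs = All.zipWith (uncurry drop-x) (x∉xs , xs⊆ys)

  length≡sum : ∀ {A : Set} (xs : List A) → length xs ≡ sum (map (λ _ → 1) xs)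
  length≡sum []       = refl
  length≡sum (_ ∷ xs) = cong suc (length≡sum xs)

  length-≤ : ∀ {A : Set} {xs ys : List A} → Unique xs → All (L._∈ ys) xs → length xs ≤ length ys
  length-≤ {xs = xs} {ys} uniq xs⊆ys =
    subst₂ _≤_ (sym (length≡sum xs)) (sym (length≡sum ys)) (sum-map-≤ (λ _ → 1) uniq xs⊆ys)

  ∈-allSubsets : ∀ {n} (S : Subset n) → S L.∈ allSubsets n
  ∈-allSubsets []            = here refl
  ∈-allSubsets (outside ∷ S) = ∈-++⁺ˡ (∈-map⁺ (outside ∷_) (∈-allSubsets S))
  ∈-allSubsets (inside  ∷ S) = ∈-++⁺ʳ _ (∈-map⁺ (inside ∷_) (∈-allSubsets S))

  allSubsets-unique : ∀ n → Unique (allSubsets n)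
  allSubsets-unique zero    = [] ∷ []
  allSubsets-unique (suc n) =
    Unique.++⁺ (Unique.map⁺ ∷-injectiveʳ (allSubsets-unique n))
               (Unique.map⁺ ∷-injectiveʳ (allSubsets-unique n)) disjoint
    where
    disjoint : Disjoint (map (outside ∷_) (allSubsets n)) (map (inside ∷_) (allSubsets n))
    disjoint (o , i) with ∈-map⁻ (outside ∷_) o | ∈-map⁻ (inside ∷_) i
    ... | _ , _ , refl | _ , _ , ()

  mapMaybe-All : ∀ {A B : Set} {P : Pred B 0ℓ} (f : A → Maybe B) xs →
                 All (λ x → ∀ y → f x ≡ just y → P y) xs → All P (mapMaybe f xs)
  mapMaybe-All f []       []       = []
  mapMaybe-All f (x ∷ xs) (p ∷ ps) with f x
  ... | just y  = p y refl ∷ mapMaybe-All f xs ps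
  ... | nothing = mapMaybe-All f xs ps

  -- `g` recovers the argument of `f` from its value, so `f` is injective where it is defined.
  mapMaybe-unique : ∀ {A B : Set} (f : A → Maybe B) (g : B → A) →
                    (∀ x y → f x ≡ just y → g y ≡ x) →
                    ∀ {xs} → Unique xs → Unique (mapMaybe f xs)
  mapMaybe-unique f g inv {[]}     []            = []
  mapMaybe-unique f g inv {x ∷ xs} (x∉xs ∷ uniq) with f x in fx
  ... | nothing = mapMaybe-unique f g inv uniq
  ... | just y  = mapMaybe-All f xs
    (All.map (λ x≢x′ y′ fx′ y≡y′ → x≢x′
       (trans (sym (inv _ _ fx)) (trans (cong g y≡y′) (inv _ _ fx′)))) x∉xs)
    ∷ mapMaybe-unique f g inv uniq

  module _ {n : ℕ} (G : Graph n) where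
    open MIS

    -- Recovers the local function of allMIS, which is not in scope, by unification.
    filterMIS : Subset n → Maybe (MIS G)
    filterMIS = proj₁ (underlying refl)
      where
      underlying : ∀ {f : Subset n → Maybe (MIS G)} → mapMaybe f (allSubsets n) ≡ allMIS G →
                   ∃ λ f → mapMaybe f (allSubsets n) ≡ allMIS G
      underlying {f} eq = f , eq

    filterMIS-vertices : ∀ S I → filterMIS S ≡ just I → vertices I ≡ S
    filterMIS-vertices S I eq with isMaximalIndependent? G S
    filterMIS-vertices S .(mis S _) refl | yes p = refl
    filterMIS-vertices S I ()            | no _

    allMIS-unique : Unique (allMIS G)
    allMIS-unique = mapMaybe-unique filterMIS vertices filterMIS-vertices (allSubsets-unique n)

    setOf : List (MIS G) → SetOfMIS G
    setOf ps I = does (Any.any? (λ p → ≡-dec Bool._≟_ (vertices I) (vertices p)) ps)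

    card-setOf : ∀ ps → card G (setOf ps) ≤ length ps
    card-setOf ps = length-≤ (Unique.filter⁺ T∘setOf? allMIS-unique)
      (All.map (Any.map (λ { refl → refl }) ∘ T-does⁻ (Any.any? _ ps))
        (All.all-filter T∘setOf? (allMIS G)))
      where
      T∘setOf? : Decidable (T ∘ setOf ps)
      T∘setOf? I = T? (setOf ps I)

    setOf-∈ : ∀ {p ps} → p L.∈ ps → setOf ps p ≡ true
    setOf-∈ {p} {ps} p∈ps = dec-true (Any.any? _ ps) (Any.map (cong vertices) p∈ps)

    K-true : ∀ {S I} → S ⊆ vertices I → K G S I ≡ true
    K-true S⊆I = dec-true (_ ⊆? _) S⊆I

  -- Counting small subsets by weight

  module _ (q : ℕ) where

    -- q^(k − |S|): the sum over all S is (q + 1)^k, and a small S has a large share of it.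
    subsetWeight : ∀ {k} → Subset k → ℕ
    subsetWeight []            = 1
    subsetWeight (outside ∷ S) = q * subsetWeight S
    subsetWeight (inside  ∷ S) = subsetWeight S

    weight-cardinality : ∀ {k} (S : Subset k) → subsetWeight S * q ^ ∣ S ∣ ≡ q ^ k
    weight-cardinality []            = refl
    weight-cardinality (outside ∷ S) =
      trans (*-assoc q (subsetWeight S) _) (cong (q *_) (weight-cardinality S))
    weight-cardinality (inside ∷ S)  =
      trans (x*[q*z] (subsetWeight S) q _) (cong (q *_) (weight-cardinality S))
      where
      x*[q*z] : ∀ x q z → x * (q * z) ≡ q * (x * z)
      x*[q*z] = solve-∀

    -- The binomial theorem, by splitting the subsets on their first entry.
    sum-weight : ∀ k → sum (map subsetWeight (allSubsets k)) ≡ suc q ^ k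
    sum-weight zero    = refl
    sum-weight (suc k) = begin
      sum (map subsetWeight (map (outside ∷_) Ss ++ map (inside ∷_) Ss))
        ≡⟨ cong sum (map-++ subsetWeight (map (outside ∷_) Ss) _) ⟩
      sum (map subsetWeight (map (outside ∷_) Ss) ++ map subsetWeight (map (inside ∷_) Ss))
        ≡⟨ sum-++ (map subsetWeight (map (outside ∷_) Ss)) _ ⟩
      sum (map subsetWeight (map (outside ∷_) Ss)) + sum (map subsetWeight (map (inside ∷_) Ss))
        ≡⟨ cong₂ (λ xs ys → sum xs + sum ys) (map-∘ Ss) (map-∘ Ss) ⟨
      sum (map (λ S → q * subsetWeight S) Ss) + sum (map subsetWeight Ss)
        ≡⟨ cong (_+ sum (map subsetWeight Ss)) (sum-* Ss) ⟩
      q * sum (map subsetWeight Ss) + sum (map subsetWeight Ss)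
        ≡⟨ cong (λ w → q * w + w) (sum-weight k) ⟩
      q * suc q ^ k + suc q ^ k
        ≡⟨ +-comm (q * suc q ^ k) _ ⟩
      suc q ^ suc k ∎
      where
      open ≡-Reasoning
      Ss = allSubsets k
      sum-* : ∀ {k} (Ss : List (Subset k)) →
              sum (map (λ S → q * subsetWeight S) Ss) ≡ q * sum (map subsetWeight Ss)
      sum-* []       = sym (*-zeroʳ q)
      sum-* (S ∷ Ss) = trans (cong (q * subsetWeight S +_) (sum-* Ss))
                             (sym (*-distribˡ-+ q (subsetWeight S) _))

    -- A set of size at most `d` has weight at least `q^k / q^d`, while all weights together make
    -- `(q + 1)^k`. The free parameter `q` trades the factor `q^d` against `(1 + 1/q)^k`.
    small-subsets-bound : ∀ .{{_ : NonZero q}} {k d} {Gs : List (Subset k)} →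
      Unique Gs → All (λ S → ∣ S ∣ ≤ d) Gs → length Gs * q ^ k ≤ q ^ d * suc q ^ k
    small-subsets-bound {k} {d} {Gs} uniq small = begin
      length Gs * q ^ k
        ≤⟨ termwise small ⟩
      q ^ d * sum (map subsetWeight Gs)
        ≤⟨ *-monoʳ-≤ (q ^ d) (sum-map-≤ subsetWeight uniq (All.tabulate λ _ → ∈-allSubsets _)) ⟩
      q ^ d * sum (map subsetWeight (allSubsets k))
        ≡⟨ cong (q ^ d *_) (sum-weight k) ⟩
      q ^ d * suc q ^ k                        ∎
      where
      open ≤-Reasoning
      termwise : ∀ {Gs : List (Subset k)} → All (λ S → ∣ S ∣ ≤ d) Gs →
                 length Gs * q ^ k ≤ q ^ d * sum (map subsetWeight Gs)
      termwise {[]}     []            = z≤n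
      termwise {S ∷ Gs} (S≤d ∷ small) = begin
        q ^ k + length Gs * q ^ k                     ≤⟨ +-mono-≤ bound (termwise small) ⟩
        q ^ d * subsetWeight S + q ^ d * sum (map subsetWeight Gs)
          ≡⟨ *-distribˡ-+ (q ^ d) (subsetWeight S) _ ⟨
        q ^ d * (subsetWeight S + sum (map subsetWeight Gs))      ∎
        where
        bound : q ^ k ≤ q ^ d * subsetWeight S
        bound = begin
          q ^ k                       ≡⟨ weight-cardinality S ⟨
          subsetWeight S * q ^ ∣ S ∣  ≤⟨ *-monoʳ-≤ (subsetWeight S) (^-monoʳ-≤ q S≤d) ⟩
          subsetWeight S * q ^ d      ≡⟨ *-comm (subsetWeight S) _ ⟩
          q ^ d * subsetWeight S      ∎

  -- Traces on finitely many points

  module _ {n : ℕ} (G : Graph n) where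
    open MIS

    -- `I` lies in `K S` but not in `K T`, so it distinguishes their traces. The pair is in list
    -- order, which puts the set added later first.
    Splits : MIS G → Subset n × Subset n → Set
    Splits I (T , S) = S ⊆ vertices I × ¬ T ⊆ vertices I

    splits? : ∀ I → Decidable (Splits I)
    splits? I (T , S) = (S ⊆? vertices I) ×-dec ¬? (T ⊆? vertices I)

    -- The trace of K_S on the points x is the trace of the hull of an irredundant subfamily,
    -- which therefore determines it.
    traces-bound : ∀ {ν} → Isν-bi G ν → 1 ≤ ν → ∀ (q : ℕ) .{{_ : NonZero q}}
      {k} (x : Fin k → MIS G) {Ss : List (Subset n)} →
      AllPairs (λ T S → ∃ λ l → Splits (x l) (T , S)) Ss →
      length Ss * q ^ k ≤ q ^ (2 * ν) * suc q ^ k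
    traces-bound {ν} ν-bi 1≤ν q {k} x {Ss} split =
      subst (λ m → m * q ^ k ≤ _) (length-map generators Ss)
        (small-subsets-bound q (AllPairs.map⁺ (AllPairs.map distinct split))
          (All.map⁺ (All.tabulate λ {S} _ →
            irredundant-bound G ν-bi 1≤ν x (proj₁ (proj₂ (proj₂ (core S)))))))
      where
      trace? : ∀ S → Decidable λ l → S ⊆ vertices (x l)
      trace? S l = S ⊆? vertices (x l)
      core : ∀ S → _
      core S = irredundant-core (vertices ∘ x) (subset (trace? S))
      generators : Subset n → Subset k
      generators = proj₁ ∘ core
      distinct : ∀ {T S} → (∃ λ l → Splits (x l) (T , S)) → generators T ≢ generators S
      -- Equal generators put `T` inside every generator of the trace of `S`, hence inside every
      -- point of that trace, and `x l` is one of them.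
      distinct {T} {S} (l , S⊆ , T⊈) eq = T⊈ λ {v} v∈T →
        proj₂ (proj₂ (proj₂ (core S)))
          (λ g g∈ → ∈-subset⁻ (trace? T)
            (proj₁ (proj₂ (core T)) (subst (g ∈_) (sym eq) g∈)) v∈T)
          l (∈-subset⁺ (trace? S) S⊆)

  -- Greedy covers of the pairs of a list

  pairs : ∀ {A : Set} → List A → List (A × A)
  pairs []       = []
  pairs (x ∷ xs) = map (x ,_) xs ++ pairs xs

  length-pairs : ∀ {A : Set} (xs : List A) → length (pairs xs) ≤ length xs * length xs
  length-pairs []       = z≤n
  length-pairs (x ∷ xs) = begin
    length (map (x ,_) xs ++ pairs xs)  ≡⟨ length-++ (map (x ,_) xs) ⟩
    length (map (x ,_) xs) + length (pairs xs)
      ≤⟨ +-mono-≤ (≤-reflexive (length-map (x ,_) xs)) (length-pairs xs) ⟩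
    m + m * m                           ≤⟨ m≤n+m (m + m * m) (suc m) ⟩
    suc m + (m + m * m)                 ≡⟨ square-suc m ⟩
    suc m * suc m                       ∎
    where
    open ≤-Reasoning
    m = length xs
    square-suc : ∀ m → suc m + (m + m * m) ≡ suc m * suc m
    square-suc = solve-∀

  pairs⁺ : ∀ {A : Set} {R : Rel A 0ℓ} {xs} → AllPairs R xs → All (uncurry R) (pairs xs)
  pairs⁺ []         = []
  pairs⁺ (Rx ∷ Rxs) = All.++⁺ (All.map⁺ Rx) (pairs⁺ Rxs)

  pairs⁻ : ∀ {A : Set} {R : Rel A 0ℓ} xs → All (uncurry R) (pairs xs) → AllPairs R xs
  pairs⁻ []       []  = []
  pairs⁻ (x ∷ xs) all =
    All.map⁻ (All.++⁻ˡ (map (x ,_) xs) all) ∷ pairs⁻ xs (All.++⁻ʳ (map (x ,_) xs) all)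

  module _ {X P : Set} {Hits : X → P → Set} (hits? : ∀ x → Decidable (Hits x))
           {Good : P → Set} (a b : ℕ) (b<a : b < a)
           (popular : ∀ ps → All Good ps → 1 ≤ length ps →
                      ∃ λ x → a * length (filter (¬? ∘ hits? x) ps) ≤ b * length ps)
           where

    -- Each chosen point leaves at most `b / a` of the pairs unhit, and at least one pair remains
    -- before the last choice. Hence `(a / b)^(length xs - 1) ≤ length ps`, stated here without
    -- division or subtraction.
    greedy-cover : ∀ ps → All Good ps →
      ∃ λ xs → All (λ p → Any (λ x → Hits x p) xs) ps ×
               (1 ≤ length ps → b * a ^ length xs ≤ a * b ^ length xs * length ps)
    greedy-cover ps = go ps (<-wellFounded (length ps))
      where
      open ≤-Reasoning
      go : ∀ ps → Acc _<_ (length ps) → All Good ps →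
        ∃ λ xs → All (λ p → Any (λ x → Hits x p) xs) ps ×
                 (1 ≤ length ps → b * a ^ length xs ≤ a * b ^ length xs * length ps)
      go []            _         _    = [] , [] , λ ()
      go ps@(p ∷ ps₀) (acc rec) good with popular ps good (s≤s z≤n)
      ... | x , pop = result
        where
        rest = filter (¬? ∘ hits? x) ps
        covered : ∀ {xs} → All (λ p → Any (λ x → Hits x p) xs) rest →
                  All (λ p → Any (λ x → Hits x p) (x ∷ xs)) ps
        covered {xs} h = All.tabulate cover
          where
          cover : ∀ {p} → p L.∈ ps → Any (λ x → Hits x p) (x ∷ xs)
          cover {p} p∈ with hits? x p
          ... | yes hit = here hit
          ... | no ¬hit = there (All.lookup h (∈-filter⁺ (¬? ∘ hits? x) p∈ ¬hit))
        rest<ps : length rest < length ps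
        rest<ps = ≰⇒> λ ps≤rest → <⇒≱ b<a (*-cancelʳ-≤ a b (length ps)
          (≤-trans (*-monoʳ-≤ a ps≤rest) pop))
        result : ∃ λ xs → All (λ p → Any (λ x → Hits x p) xs) ps ×
          (1 ≤ length ps → b * a ^ length xs ≤ a * b ^ length xs * length ps)
        result with go rest (rec rest<ps) (All.filter⁺ (¬? ∘ hits? x) good)
        ... | xs , cov , bound with 1 ≤? length rest
        ...   | yes 1≤ = x ∷ xs , covered cov , λ _ → begin
          b * (a * a ^ length xs)                      ≡⟨ swap b a (a ^ length xs) ⟩
          a * (b * a ^ length xs)                      ≤⟨ *-monoʳ-≤ a (bound 1≤) ⟩
          a * (a * b ^ length xs * length rest)        ≡⟨ assoc a a (b ^ length xs) (length rest) ⟩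
          a * b ^ length xs * (a * length rest)        ≤⟨ *-monoʳ-≤ (a * b ^ length xs) pop ⟩
          a * b ^ length xs * (b * length ps)          ≡⟨ assoc′ a b (b ^ length xs) (length ps) ⟩
          a * (b * b ^ length xs) * length ps          ∎
          where
          swap : ∀ x y z → x * (y * z) ≡ y * (x * z)
          swap = solve-∀
          assoc : ∀ x y z w → x * (y * z * w) ≡ x * z * (y * w)
          assoc = solve-∀
          assoc′ : ∀ x y z w → x * z * (y * w) ≡ x * (y * z) * w
          assoc′ = solve-∀
        -- Nothing remains, so `x` is the last choice, for which no decrease is counted.
        ...   | no ¬1≤ = x ∷ [] , covered (no-rest rest ¬1≤) , λ _ → begin
          b * (a * 1)                ≡⟨ swap b a ⟩
          a * (b * 1) * 1            ≤⟨ *-monoʳ-≤ (a * (b * 1)) (s≤s z≤n) ⟩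
          a * (b * 1) * length ps    ∎
          where
          swap : ∀ x y → x * (y * 1) ≡ y * (x * 1) * 1
          swap = solve-∀
          no-rest : ∀ rest → ¬ 1 ≤ length rest → All (λ p → Any (λ x → Hits x p) []) rest
          no-rest []      _    = []
          no-rest (_ ∷ _) ¬1≤ = contradiction (s≤s z≤n) ¬1≤

  length-filter-¬ : ∀ {A : Set} {P : Pred A 0ℓ} (P? : Decidable P) xs →
                    length (filter P? xs) + length (filter (¬? ∘ P?) xs) ≡ length xs
  length-filter-¬ P? []       = refl
  length-filter-¬ P? (x ∷ xs) with P? x
  ... | yes _ = cong suc (length-filter-¬ P? xs)
  ... | no _  = trans (+-suc _ _) (cong suc (length-filter-¬ P? xs))

  -- Arithmetic of the packing bound

  -- (1 + 1/q)^4 ≤ 1 + 15/q = 1 + 1/r for q = 15r.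
  fourth-power-drop : ∀ {q r} h u → q ≡ 15 * r → 1 ≤ r → h + u ≤ r * h →
    suc q ^ 4 * u ≤ q ^ 4 * (h + u)
  fourth-power-drop {q} {suc r′} h u q≡ _ h+u≤rh = begin
    suc q ^ 4 * u
      ≤⟨ *-monoˡ-≤ u (fourth (14 + 15 * r′) q≡1+ (trans (cong suc q≡1+) (+-comm 1 _))) ⟩
    (q ^ 4 + 15 * q ^ 3) * u                 ≡⟨ *-distribʳ-+ u (q ^ 4) (15 * q ^ 3) ⟩
    q ^ 4 * u + 15 * q ^ 3 * u
      ≤⟨ +-monoʳ-≤ (q ^ 4 * u) (*-monoʳ-≤ (15 * q ^ 3) (≤-trans (m≤n+m u h) h+u≤rh)) ⟩
    q ^ 4 * u + 15 * q ^ 3 * (suc r′ * h)    ≡⟨ collect q (suc r′) h u ⟩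
    q ^ 3 * (q * u + 15 * suc r′ * h)        ≡⟨ cong (λ z → q ^ 3 * (q * u + z * h)) q≡ ⟨
    q ^ 3 * (q * u + q * h)                  ≡⟨ collect′ q h u ⟩
    q ^ 4 * (h + u)                          ∎
    where
    open ≤-Reasoning
    expand : ∀ r′ → 15 * suc r′ ≡ 14 + 15 * r′ + 1
    expand = solve-∀
    q≡1+ : q ≡ 14 + 15 * r′ + 1
    q≡1+ = trans q≡ (expand r′)
    -- The constant is `15 = 4 + 6 + 4 + 1`. In terms of `q′ = q - 1` the difference of the two
    -- sides has only non-negative coefficients, so it can be added explicitly.
    fourth : ∀ q′ {q 1+q} → q ≡ q′ + 1 → 1+q ≡ q′ + 1 + 1 → 1+q ^ 4 ≤ q ^ 4 + 15 * q ^ 3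
    fourth q′ refl refl =
      ≤-trans (m≤m+n _ (11 * q′ ^ 3 + 27 * q′ ^ 2 + 17 * q′)) (≤-reflexive (identity q′))
      where
      identity : ∀ x → (x + 1 + 1) ^ 4 + (11 * x ^ 3 + 27 * x ^ 2 + 17 * x)
                     ≡ (x + 1) ^ 4 + 15 * (x + 1) ^ 3
      identity = solve 1 (λ x →
        (x :+ con 1 :+ con 1) :^ 4 :+ (con 11 :* x :^ 3 :+ con 27 :* x :^ 2 :+ con 17 :* x)
          := (x :+ con 1) :^ 4 :+ con 15 :* (x :+ con 1) :^ 3) refl
    collect : ∀ q r h u → q ^ 4 * u + 15 * q ^ 3 * (r * h) ≡ q ^ 3 * (q * u + 15 * r * h)
    collect = solve 4 (λ q r h u →
      q :^ 4 :* u :+ con 15 :* q :^ 3 :* (r :* h) := q :^ 3 :* (q :* u :+ con 15 :* r :* h)) refl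
    collect′ : ∀ q h u → q ^ 3 * (q * u + q * h) ≡ q ^ 4 * (h + u)
    collect′ = solve 3 (λ q h u →
      q :^ 3 :* (q :* u :+ q :* h) := q :^ 4 :* (h :+ u)) refl

  -- With `c = q^d` and `z = (1 + 1/q)^k` the hypotheses give `m ≤ c z` and `z^4 ≤ 16 m^2`, where
  -- `(1 + 1/q)^4 ≤ 16` pays for the last greedy point. So `m^4 ≤ 16 c^4 m^2`, that is `m ≤ 4 c^2`.
  -- The fourth power is chosen so that only `m^2` returns on the right.
  packing-arithmetic : ∀ (q d k m : ℕ) .{{_ : NonZero q}} .{{_ : NonZero m}} →
    m * q ^ k ≤ q ^ d * suc q ^ k →
    q ^ 4 * (suc q ^ 4) ^ k ≤ suc q ^ 4 * (q ^ 4) ^ k * (m * m) →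
    m ≤ 4 * q ^ (2 * d)
  packing-arithmetic q d k m few long = ≮⇒≥ λ 4cc<m → <⇒≱ (*-mono-< 4cc<m 4cc<m) m²≤
    where
    open ≤-Reasoning
    A = suc q ^ k
    B = q ^ k
    c = q ^ d
    instance
      B≢0 : NonZero B
      B≢0 = m^n≢0 q k
      q⁴≢0 : NonZero (q ^ 4)
      q⁴≢0 = m^n≢0 q 4
      scale≢0 : NonZero (m * m * B ^ 4)
      scale≢0 = m*n≢0 (m * m) (B ^ 4) {{m*n≢0 m m}} {{m^n≢0 B 4}}
    power-comm : ∀ x → (x ^ 4) ^ k ≡ (x ^ k) ^ 4
    power-comm x = trans (^-*-assoc x 4 k) (trans (cong (x ^_) (*-comm 4 k)) (sym (^-*-assoc x k 4)))
    1+q≤2q : suc q ≤ 2 * q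
    1+q≤2q = subst (suc q ≤_) (cong (q +_) (sym (+-identityʳ q))) (+-monoˡ-≤ q (ℕ.>-nonZero⁻¹ q))
    A⁴≤ : A ^ 4 ≤ 16 * B ^ 4 * (m * m)
    A⁴≤ = *-cancelˡ-≤ (q ^ 4) (begin
      q ^ 4 * A ^ 4                        ≡⟨ cong (q ^ 4 *_) (power-comm (suc q)) ⟨
      q ^ 4 * (suc q ^ 4) ^ k              ≤⟨ long ⟩
      suc q ^ 4 * (q ^ 4) ^ k * (m * m)
        ≤⟨ *-monoˡ-≤ (m * m) (*-monoˡ-≤ ((q ^ 4) ^ k) (^-monoˡ-≤ 4 1+q≤2q)) ⟩
      (2 * q) ^ 4 * (q ^ 4) ^ k * (m * m)  ≡⟨ cong (λ z → (2 * q) ^ 4 * z * (m * m)) (power-comm q) ⟩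
      (2 * q) ^ 4 * B ^ 4 * (m * m)        ≡⟨ regroup q B m ⟩
      q ^ 4 * (16 * B ^ 4 * (m * m))       ∎)
      where
      regroup : ∀ q B m → (2 * q) ^ 4 * B ^ 4 * (m * m) ≡ q ^ 4 * (16 * B ^ 4 * (m * m))
      regroup = solve 3 (λ q B m →
        (con 2 :* q) :^ 4 :* B :^ 4 :* (m :* m) := q :^ 4 :* (con 16 :* B :^ 4 :* (m :* m))) refl
    m²≤ : m * m ≤ (4 * q ^ (2 * d)) * (4 * q ^ (2 * d))
    m²≤ = *-cancelʳ-≤ _ _ (m * m * B ^ 4) (begin
      m * m * (m * m * B ^ 4)                   ≡⟨ expand m B ⟩
      (m * B) ^ 4                               ≤⟨ ^-monoˡ-≤ 4 few ⟩
      (c * A) ^ 4                               ≡⟨ distrib c A ⟩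
      c ^ 4 * A ^ 4                             ≤⟨ *-monoʳ-≤ (c ^ 4) A⁴≤ ⟩
      c ^ 4 * (16 * B ^ 4 * (m * m))            ≡⟨ regroup c B m ⟩
      (4 * c ^ 2) * (4 * c ^ 2) * (m * m * B ^ 4)
        ≡⟨ cong (λ z → (4 * z) * (4 * z) * (m * m * B ^ 4))
                (trans (^-*-assoc q d 2) (cong (q ^_) (*-comm d 2))) ⟩
      (4 * q ^ (2 * d)) * (4 * q ^ (2 * d)) * (m * m * B ^ 4) ∎)
      where
      expand : ∀ m B → m * m * (m * m * B ^ 4) ≡ (m * B) ^ 4
      expand = solve 2 (λ m B →
        m :* m :* (m :* m :* B :^ 4) := (m :* B) :^ 4) refl
      distrib : ∀ c A → (c * A) ^ 4 ≡ c ^ 4 * A ^ 4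
      distrib = solve 2 (λ c A →
        (c :* A) :^ 4 := c :^ 4 :* A :^ 4) refl
      regroup : ∀ c B m → c ^ 4 * (16 * B ^ 4 * (m * m)) ≡ (4 * c ^ 2) * (4 * c ^ 2) * (m * m * B ^ 4)
      regroup = solve 3 (λ c B m →
        c :^ 4 :* (con 16 :* B :^ 4 :* (m :* m))
          := (con 4 :* c :^ 2) :* (con 4 :* c :^ 2) :* (m :* m :* B :^ 4)) refl

  -- Moves a constant factor into the base, which a positive exponent allows.
  *-^-≤ : ∀ c q {k} .{{_ : NonZero c}} → 1 ≤ k → c * q ^ k ≤ (c * q) ^ k
  *-^-≤ c q {suc zero}       _ = ≤-reflexive (sym (*-assoc c q 1))
  *-^-≤ c q {suc k@(suc _)} _ = begin
    c * (q * q ^ k)     ≡⟨ *-assoc c q _ ⟨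
    c * q * q ^ k       ≤⟨ *-monoʳ-≤ (c * q) (≤-trans (m≤n*m (q ^ k) c) (*-^-≤ c q {k} (s≤s z≤n))) ⟩
    c * q * (c * q) ^ k ∎
    where open ≤-Reasoning

  -- Length of a separated sequence

  module _ {n : ℕ} (G : Graph n) where
    open MIS

    -- A point splitting a fraction `1 / r` of the pairs leaves at most `(q / (q + 1))^4` of them,
    -- for `q = 15 r`. So few greedy points split all pairs; the traces on these points are
    -- distinct, and `traces-bound` with `packing-arithmetic` applies for `d = 2 ν`.
    separated-length-bound : ∀ {ν} → Isν-bi G ν → 1 ≤ ν →
      (Separated : Subset n → Subset n → Set) (q r : ℕ) .{{_ : NonZero q}} → q ≡ 15 * r → 1 ≤ r →
      (∀ ps → All (uncurry Separated) ps →
        ∃ λ I → length ps ≤ r * length (filter (splits? G I) ps)) →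
      ∀ {Ss} → AllPairs Separated Ss → length Ss ≤ (4 * q) ^ (2 * (2 * ν))
    separated-length-bound {ν} ν-bi 1≤ν Separated q r q≡15r 1≤r popular {Ss} sep =
      ≤-trans (length-bound Ss sep)
        (*-^-≤ 4 q (*-mono-≤ {1} {2} (s≤s z≤n) (*-mono-≤ {1} {2} (s≤s z≤n) 1≤ν)))
      where
      few-unsplit : ∀ ps → All (uncurry Separated) ps → 1 ≤ length ps →
        ∃ λ I → suc q ^ 4 * length (filter (¬? ∘ splits? G I) ps) ≤ q ^ 4 * length ps
      few-unsplit ps all-sep _ with popular ps all-sep
      ... | I , pop = I , subst (λ m → suc q ^ 4 * unsplit ≤ q ^ 4 * m) count
          (fourth-power-drop split unsplit q≡15r 1≤r (subst (_≤ r * split) (sym count) pop))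
        where
        split   = length (filter (splits? G I) ps)
        unsplit = length (filter (¬? ∘ splits? G I) ps)
        count : split + unsplit ≡ length ps
        count = length-filter-¬ (splits? G I) ps
      1≤c*q^e : ∀ e → 1 ≤ 4 * q ^ e
      1≤c*q^e e = *-mono-≤ {1} {4} {1} {q ^ e} (s≤s z≤n) (m^n>0 q e)
      length-bound : ∀ Ss → AllPairs Separated Ss → length Ss ≤ 4 * q ^ (2 * (2 * ν))
      -- Fewer than two sets form no pair, and the length bound of `greedy-cover` needs one.
      length-bound []           _   = z≤n
      length-bound (_ ∷ [])     _   = 1≤c*q^e (2 * (2 * ν))
      length-bound Ss@(_ ∷ _ ∷ _) sep
        with greedy-cover (splits? G) (suc q ^ 4) (q ^ 4) (^-monoˡ-< 4 (n<1+n q)) few-unsplit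
               (pairs Ss) (pairs⁺ sep)
      ... | xs , covered , bound = packing-arithmetic q (2 * ν) (length xs) (length Ss)
          (traces-bound G ν-bi 1≤ν q (List.lookup xs)
            (AllPairs.map (λ any → index any , lookup-index any) (pairs⁻ Ss covered)))
          (≤-trans (bound (s≤s z≤n)) (*-monoʳ-≤ (suc q ^ 4 * (q ^ 4) ^ length xs) (length-pairs Ss)))

open Combinatorics

-- Indicators with values in ℕ

indicator : {P : Set} → Dec P → ℕ
indicator P? = if does P? then 1 else 0

length-filter-∷ : ∀ {A : Set} {P : Pred A 0ℓ} (P? : Decidable P) x xs →
  length (filter P? (x ∷ xs)) ≡ indicator (P? x) ℕ.+ length (filter P? xs)
length-filter-∷ P? x xs with P? x
... | yes _ = ≡.refl
... | no _  = ≡.refl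

indicator-mono : ∀ {P Q : Set} (P? : Dec P) (Q? : Dec Q) → (P → Q) → indicator P? ℕ.≤ indicator Q?
indicator-mono (no _)  _       _ = z≤n
indicator-mono (yes _) (yes _) _ = ℕ.≤-refl
indicator-mono (yes p) (no ¬q) f = contradiction (f p) ¬q

indicator-≤1 : ∀ {P : Set} (P? : Dec P) → indicator P? ℕ.≤ 1
indicator-≤1 (yes _) = ℕ.≤-refl
indicator-≤1 (no _)  = z≤n

indicator-union : ∀ {P Q S : Set} (P? : Dec P) (Q? : Dec Q) (S? : Dec S) → (P → Q ⊎ S) →
                  indicator P? ℕ.≤ indicator Q? ℕ.+ indicator S?
indicator-union (no _)  _       _       _ = z≤n
indicator-union (yes _) (yes _) _       _ = s≤s z≤n
indicator-union (yes _) (no _)  (yes _) _ = ℕ.≤-refl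
indicator-union (yes p) (no ¬q) (no ¬s) f with f p
... | inj₁ q = contradiction q ¬q
... | inj₂ s = contradiction s ¬s

indicator-disjoint : ∀ {P Q S : Set} (P? : Dec P) (Q? : Dec Q) (S? : Dec S) →
                     (P → S) → (Q → S) → (P → ¬ Q) →
                     indicator P? ℕ.+ indicator Q? ℕ.≤ indicator S?
indicator-disjoint (no _)  Q?      S? _   Q→S _ = indicator-mono Q? S? Q→S
indicator-disjoint (yes p) (yes q) S? _   _   d = contradiction q (d p)
indicator-disjoint (yes p) (no _)  S? P→S _   _ = indicator-mono (yes p) S? P→S

-- Order and natural multiples in a complete ordered field

module OrderedField (R : CompleteOrderedField) where
  open CompleteOrderedField R

  module ≤ = IsDecTotalOrder isDecTotalOrder
  open ≤ public using () renaming (_≤?_ to infix 4 _≤?_)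

  open RingProperties ring public using (-1*x≈-x; -‿involutive)
  open SemiringMult semiring public
    using (×-congʳ; ×-congˡ; ×-homo-+; ×-assocˡ; ×1-homo-*; ×-homo-1; ×-assoc-*)
  open CommutativeSemigroupProperties +-commutativeSemigroup public using (interchange)
  open CommutativeMonoidMult +-commutativeMonoid public using (×-distrib-+)

  ≤-poset : Poset _ _ _
  ≤-poset = record { isPartialOrder = ≤.isPartialOrder }

  module ≤-Reasoning = PartialOrderReasoning ≤-poset
  open ≤-Reasoning

  ≰⇒≥ : ∀ {x y} → ¬ (x ≤ y) → y ≤ x
  ≰⇒≥ {x} {y} x≰y with ≤.total x y
  ... | inj₁ x≤y = contradiction x≤y x≰y
  ... | inj₂ y≤x = y≤x

  +-monoʳ-≤ : ∀ z {x y} → x ≤ y → z + x ≤ z + y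
  +-monoʳ-≤ z {x} {y} x≤y = begin
    z + x ≈⟨ +-comm z x ⟩
    x + z ≤⟨ +-monoˡ-≤ z x≤y ⟩
    y + z ≈⟨ +-comm y z ⟩
    z + y ∎

  +-mono-≤ : ∀ {x y u v} → x ≤ y → u ≤ v → x + u ≤ y + v
  +-mono-≤ {x} {y} {u} x≤y u≤v = ≤.trans (+-monoˡ-≤ u x≤y) (+-monoʳ-≤ y u≤v)

  x-y+y≈x : ∀ x y → x + (- y) + y ≈ x
  x-y+y≈x x y = trans (+-assoc x (- y) y) (trans (+-congˡ (-‿inverseˡ y)) (+-identityʳ x))

  x+y-y≈x : ∀ x y → x + y + (- y) ≈ x
  x+y-y≈x x y = trans (+-assoc x y (- y)) (trans (+-congˡ (-‿inverseʳ y)) (+-identityʳ x))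

  y+[x-y]≈x : ∀ x y → y + (x + (- y)) ≈ x
  y+[x-y]≈x x y = trans (+-comm y _) (x-y+y≈x x y)

  +-cancelʳ-≤ : ∀ z {x y} → x + z ≤ y + z → x ≤ y
  +-cancelʳ-≤ z {x} {y} h = begin
    x              ≈⟨ x+y-y≈x x z ⟨
    x + z + (- z)  ≤⟨ +-monoˡ-≤ (- z) h ⟩
    y + z + (- z)  ≈⟨ x+y-y≈x y z ⟩
    y              ∎

  +-cancelˡ-≤ : ∀ z {x y} → z + x ≤ z + y → x ≤ y
  +-cancelˡ-≤ z {x} {y} h = +-cancelʳ-≤ z (begin
    x + z ≈⟨ +-comm x z ⟩
    z + x ≤⟨ h ⟩
    z + y ≈⟨ +-comm z y ⟩
    y + z ∎)

  x≤y⇒0≤y-x : ∀ {x y} → x ≤ y → 0# ≤ y + (- x)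
  x≤y⇒0≤y-x {x} {y} x≤y = begin
    0#         ≈⟨ -‿inverseʳ x ⟨
    x + (- x)  ≤⟨ +-monoˡ-≤ (- x) x≤y ⟩
    y + (- x)  ∎

  x≤y+x : ∀ {x y} → 0# ≤ y → x ≤ y + x
  x≤y+x {x} {y} 0≤y = begin
    x       ≈⟨ +-identityˡ x ⟨
    0# + x  ≤⟨ +-monoˡ-≤ x 0≤y ⟩
    y + x   ∎

  *-monoʳ-≤ : ∀ {z x y} → 0# ≤ z → x ≤ y → z * x ≤ z * y
  *-monoʳ-≤ {z} {x} {y} 0≤z x≤y = begin
    z * x                    ≤⟨ x≤y+x (*-nonNeg 0≤z (x≤y⇒0≤y-x x≤y)) ⟩
    z * (y + (- x)) + z * x  ≈⟨ distribˡ z _ x ⟨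
    z * (y + (- x) + x)      ≈⟨ *-congˡ (x-y+y≈x y x) ⟩
    z * y                    ∎

  *-monoˡ-≤ : ∀ {z x y} → 0# ≤ z → x ≤ y → x * z ≤ y * z
  *-monoˡ-≤ {z} {x} {y} 0≤z x≤y = begin
    x * z ≈⟨ *-comm x z ⟩
    z * x ≤⟨ *-monoʳ-≤ 0≤z x≤y ⟩
    z * y ≈⟨ *-comm z y ⟩
    y * z ∎

  *-cancelʳ-≤-pos : ∀ {z x y} → 0# < z → x * z ≤ y * z → x ≤ y
  *-cancelʳ-≤-pos {z} {x} {y} (0≤z , 0≉z) xz≤yz with ≤.total x y
  ... | inj₁ x≤y = x≤y
  ... | inj₂ y≤x = ≤.reflexive (begin-equality
    x                 ≈⟨ cancel x ⟨
    x * z * z ⁻¹      ≈⟨ *-congʳ (≤.antisym xz≤yz (*-monoˡ-≤ 0≤z y≤x)) ⟩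
    y * z * z ⁻¹      ≈⟨ cancel y ⟩
    y                 ∎)
    where
    cancel : ∀ x → x * z * z ⁻¹ ≈ x
    cancel x = trans (*-assoc x z (z ⁻¹))
      (trans (*-congˡ (⁻¹-inverseʳ z λ z≈0 → 0≉z (sym z≈0))) (*-identityʳ x))

  0≤1 : 0# ≤ 1#
  0≤1 with ≤.total 0# 1#
  ... | inj₁ 0≤1 = 0≤1
  ... | inj₂ 1≤0 = begin
    0#               ≤⟨ *-nonNeg 0≤-1 0≤-1 ⟩
    (- 1#) * (- 1#)  ≈⟨ -1*x≈-x (- 1#) ⟩
    - (- 1#)         ≈⟨ -‿involutive 1# ⟩
    1#               ∎
    where
    0≤-1 : 0# ≤ - 1#
    0≤-1 = ≤.trans (x≤y⇒0≤y-x 1≤0) (≤.reflexive (+-identityˡ _))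

  1≰0 : ¬ (1# ≤ 0#)
  1≰0 1≤0 = 0≉1 (≤.antisym 0≤1 1≤0)

  ·-monoʳ-≤ : ∀ n {x y} → x ≤ y → n · x ≤ n · y
  ·-monoʳ-≤ zero    _   = ≤.refl
  ·-monoʳ-≤ (suc n) x≤y = +-mono-≤ x≤y (·-monoʳ-≤ n x≤y)

  ·-nonNeg : ∀ n {x} → 0# ≤ x → 0# ≤ n · x
  ·-nonNeg zero    _   = ≤.refl
  ·-nonNeg (suc n) 0≤x = ≤.trans (·-nonNeg n 0≤x) (x≤y+x 0≤x)

  ·-monoˡ-≤ : ∀ {m n x} → 0# ≤ x → m ℕ.≤ n → m · x ≤ n · x
  ·-monoˡ-≤ {n = n} 0≤x z≤n = ·-nonNeg n 0≤x
  ·-monoˡ-≤ 0≤x (s≤s m≤n) = +-monoʳ-≤ _ (·-monoˡ-≤ 0≤x m≤n)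

  ·≈fromℕ* : ∀ n x → n · x ≈ fromℕ n * x
  ·≈fromℕ* n x = sym (trans (×-assoc-* n 1# x) (×-congʳ n (*-identityˡ x)))

  -- The supremum axiom yields no witness, only the impossibility of there being none.
  archimedean : ∀ y → ¬ ¬ ∃ λ s → y ≤ fromℕ s
  archimedean y unbounded with complete (λ x → ∃ λ s → x ≈ fromℕ s) (0# , 0 , refl)
    (y , λ { x (s , x≈s) → ≤.trans (≤.reflexive x≈s) (≰⇒≥ λ y≤s → unbounded (s , y≤s)) })
  ... | b , upper , least = 1≰0 (+-cancelʳ-≤ b (begin
    1# + b              ≤⟨ +-monoʳ-≤ 1# (least (b + (- 1#)) b-1-upper) ⟩
    1# + (b + (- 1#))   ≈⟨ y+[x-y]≈x b 1# ⟩
    b                   ≈⟨ +-identityˡ b ⟨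
    0# + b              ∎))
    where
    b-1-upper : IsUpperBound (λ x → ∃ λ s → x ≈ fromℕ s) (b + (- 1#))
    b-1-upper x (s , x≈s) = begin
      x                        ≈⟨ x≈s ⟩
      fromℕ s                  ≈⟨ x+y-y≈x (fromℕ s) 1# ⟨
      fromℕ s + 1# + (- 1#)    ≈⟨ +-congʳ (+-comm (fromℕ s) 1#) ⟩
      fromℕ (suc s) + (- 1#)   ≤⟨ +-monoˡ-≤ (- 1#) (upper _ (suc s , refl)) ⟩
      b + (- 1#)               ∎

  -- Descends from a given natural upper bound to the least one. The starting bound is an argument
  -- because `archimedean` supplies one only under a double negation.
  ceiling : ∀ {y} → 0# ≤ y → ∀ s → y ≤ fromℕ s → ∃ λ s → y ≤ fromℕ s × fromℕ s ≤ y + 1#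
  ceiling {y} 0≤y zero    y≤0   = 0 , y≤0 , ≤.trans 0≤y (≤.trans (x≤y+x 0≤1) (≤.reflexive (+-comm 1# y)))
  ceiling {y} 0≤y (suc s) y≤1+s with y ≤? fromℕ s
  ... | yes y≤s = ceiling 0≤y s y≤s
  ... | no y≰s  = suc s , y≤1+s , (begin
    1# + fromℕ s ≤⟨ +-monoʳ-≤ 1# (≰⇒≥ y≰s) ⟩
    1# + y       ≈⟨ +-comm 1# y ⟩
    y + 1#       ∎)

  -- Weighted sums over a finite list

  module WeightedSum {X : Set} (L : List X) (w : X → ℝ) (0≤w : ∀ x → 0# ≤ w x) where

    -- An integral against weights of arbitrary total, so that probability measures and fractional
    -- transversals are treated alike. Integrands are ℕ-valued, so pointwise inequalities are proved
    -- in ℕ.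
    𝔼 : (X → ℕ) → ℝ
    𝔼 f = sumOver L λ x → f x · w x

    𝔼-mono-All : ∀ {f g} → All (λ x → f x ℕ.≤ g x) L → 𝔼 f ≤ 𝔼 g
    𝔼-mono-All = go L
      where
      go : ∀ L {f g : X → ℕ} → All (λ x → f x ℕ.≤ g x) L →
           sumOver L (λ x → f x · w x) ≤ sumOver L (λ x → g x · w x)
      go []      []          = ≤.refl
      go (x ∷ L) (fx≤gx ∷ h) = +-mono-≤ (·-monoˡ-≤ (0≤w x) fx≤gx) (go L h)

    𝔼-mono : ∀ {f g} → (∀ x → f x ℕ.≤ g x) → 𝔼 f ≤ 𝔼 g
    𝔼-mono f≤g = 𝔼-mono-All (All.universal f≤g L)

    𝔼-0 : 𝔼 (λ _ → 0) ≈ 0#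
    𝔼-0 = go L
      where
      go : ∀ L → sumOver L (λ x → 0 · w x) ≈ 0#
      go []      = refl
      go (x ∷ L) = trans (+-identityˡ _) (go L)

    𝔼-+ : ∀ f g → 𝔼 (λ x → f x ℕ.+ g x) ≈ 𝔼 f + 𝔼 g
    𝔼-+ f g = go L
      where
      go : ∀ L → sumOver L (λ x → (f x ℕ.+ g x) · w x) ≈
                 sumOver L (λ x → f x · w x) + sumOver L (λ x → g x · w x)
      go []      = sym (+-identityˡ 0#)
      go (x ∷ L) = trans (+-cong (×-homo-+ (w x) (f x) (g x)) (go L)) (interchange _ _ _ _)

    𝔼-* : ∀ r f → 𝔼 (λ x → r ℕ.* f x) ≈ r · 𝔼 f
    𝔼-* zero    f = 𝔼-0
    𝔼-* (suc r) f = trans (𝔼-+ f (λ x → r ℕ.* f x)) (+-congˡ (𝔼-* r f))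

    total-weight : ℝ
    total-weight = 𝔼 (λ _ → 1)

    𝔼-const : ∀ n → 𝔼 (λ _ → n) ≈ n · total-weight
    𝔼-const zero    = 𝔼-0
    𝔼-const (suc n) = trans (𝔼-+ (λ _ → 1) (λ _ → n)) (+-congˡ (𝔼-const n))

    total-weight≈ : total-weight ≈ sumOver L w
    total-weight≈ = go L
      where
      go : ∀ L → sumOver L (λ x → 1 · w x) ≈ sumOver L w
      go []      = refl
      go (x ∷ L) = +-cong (×-homo-1 (w x)) (go L)

    𝔼-indicator : ∀ (A : X → Bool) {P : Pred X 0ℓ} (P? : Decidable P) → (∀ x → A x ≡ does (P? x)) →
      sumOver L (λ x → if A x then w x else 0#) ≈ 𝔼 (λ x → indicator (P? x))
    𝔼-indicator A P? A≡P = go L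
      where
      branch : ∀ b x → (if b then x else 0#) ≈ (if b then 1 else 0) · x
      branch true  x = sym (×-homo-1 x)
      branch false x = refl
      go : ∀ L → sumOver L (λ x → if A x then w x else 0#) ≈
                 sumOver L (λ x → indicator (P? x) · w x)
      go []      = refl
      go (x ∷ L) rewrite A≡P x = +-cong (branch (does (P? x)) (w x)) (go L)

    -- Averaging: each `p` is hit by at least a fraction `1 / r` of the weight, so some point hits
    -- at least that fraction of `ps`.
    popular-point : ∀ {P : Set} {Hits : X → P → Set} (hits? : ∀ x → Decidable (Hits x)) r ps →
      0# < total-weight →
      All (λ p → total-weight ≤ r · 𝔼 (λ x → indicator (hits? x p))) ps →
      ∃ λ x → length ps ℕ.≤ r ℕ.* length (filter (hits? x) ps)
    popular-point hits? r ps (0≤W , 0≉W) heavy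
      with Any.any? (λ x → length ps ℕ.≤? r ℕ.* length (filter (hits? x) ps)) L
    ... | yes found = Any.satisfied found
    ... | no ¬found = contradiction (≤.antisym 0≤W W≤0) 0≉W
      where
      hits : _ → X → ℕ
      hits ps x = length (filter (hits? x) ps)
      double-count : ∀ {ps} → All (λ p → total-weight ≤ r · 𝔼 (λ x → indicator (hits? x p))) ps →
                     length ps · total-weight ≤ r · 𝔼 (hits ps)
      double-count {[]}     []      = ·-nonNeg r (≤.reflexive (sym 𝔼-0))
      double-count {p ∷ ps} (h ∷ hs) = begin
        total-weight + length ps · total-weight
          ≤⟨ +-mono-≤ h (double-count hs) ⟩
        r · 𝔼 (λ x → indicator (hits? x p)) + r · 𝔼 (hits ps)
          ≈⟨ ×-distrib-+ _ _ r ⟨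
        r · (𝔼 (λ x → indicator (hits? x p)) + 𝔼 (hits ps))
          ≈⟨ ×-congʳ r (𝔼-+ (λ x → indicator (hits? x p)) (hits ps)) ⟨
        r · 𝔼 (λ x → indicator (hits? x p) ℕ.+ hits ps x)
          ≤⟨ ·-monoʳ-≤ r (𝔼-mono λ x → ℕ.≤-reflexive (≡.sym (length-filter-∷ (hits? x) p ps))) ⟩
        r · 𝔼 (hits (p ∷ ps)) ∎
      -- If every point fails, the strict inequality `r * hits < length ps` in ℕ leaves room for one
      -- more unit at each point, hence for an extra `total-weight` in the sum.
      W≤0 : total-weight ≤ 0#
      W≤0 = +-cancelʳ-≤ (length ps · total-weight) (begin
        total-weight + length ps · total-weight ≤⟨ +-monoʳ-≤ total-weight (double-count heavy) ⟩
        total-weight + r · 𝔼 (hits ps)          ≈⟨ +-congˡ (𝔼-* r (hits ps)) ⟨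
        total-weight + 𝔼 (λ x → r ℕ.* hits ps x) ≈⟨ 𝔼-+ (λ _ → 1) (λ x → r ℕ.* hits ps x) ⟨
        𝔼 (λ x → suc (r ℕ.* hits ps x))         ≤⟨ 𝔼-mono-All (All.map ℕ.≰⇒> (All.¬Any⇒All¬ L ¬found)) ⟩
        𝔼 (λ _ → length ps)                     ≈⟨ 𝔼-const (length ps) ⟩
        length ps · total-weight                ≈⟨ +-identityˡ _ ⟨
        0# + length ps · total-weight           ∎)

  -- Exponential, logarithm and real powers

  module Exponential (E : NaturalExpLog R) where
    open NaturalExpLog E

    1≤⇒0≤ : ∀ {x} → 1# ≤ x → 0# ≤ x
    1≤⇒0≤ = ≤.trans 0≤1

    1≤⇒0< : ∀ {x} → 1# ≤ x → 0# < x
    1≤⇒0< 1≤x = 1≤⇒0≤ 1≤x , λ 0≈x → 1≰0 (≤.trans 1≤x (≤.reflexive (sym 0≈x)))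

    0≤x⇒1≤exp : ∀ {x} → 0# ≤ x → 1# ≤ exp x
    0≤x⇒1≤exp {x} 0≤x = begin
      1#      ≤⟨ x≤y+x 0≤x ⟩
      x + 1#  ≈⟨ +-comm x 1# ⟩
      1# + x  ≤⟨ 1+x≤exp x ⟩
      exp x   ∎

    exp-0 : exp 0# ≈ 1#
    exp-0 = ≤.antisym (*-cancelʳ-≤-pos (1≤⇒0< 1≤exp0) (begin
      exp 0# * exp 0#  ≈⟨ exp-+ 0# 0# ⟨
      exp (0# + 0#)    ≈⟨ exp-cong (+-identityˡ 0#) ⟩
      exp 0#           ≈⟨ *-identityˡ _ ⟨
      1# * exp 0#      ∎)) 1≤exp0
      where
      1≤exp0 : 1# ≤ exp 0#
      1≤exp0 = 0≤x⇒1≤exp ≤.refl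

    exp-neg : ∀ x → exp (- x) * exp x ≈ 1#
    exp-neg x = trans (sym (exp-+ (- x) x)) (trans (exp-cong (-‿inverseˡ x)) exp-0)

    -- For `x ≤ 0`, a value `exp x ≤ 0` would make `exp (- x) * exp x = 1` non-positive.
    exp-nonNeg : ∀ x → 0# ≤ exp x
    exp-nonNeg x with ≤.total 0# x | ≤.total 0# (exp x)
    ... | _        | inj₁ 0≤e = 0≤e
    ... | inj₁ 0≤x | inj₂ _   = 1≤⇒0≤ (0≤x⇒1≤exp 0≤x)
    ... | inj₂ x≤0 | inj₂ e≤0 = contradiction (begin
      1#                 ≈⟨ exp-neg x ⟨
      exp (- x) * exp x  ≤⟨ *-monoʳ-≤ (1≤⇒0≤ (0≤x⇒1≤exp 0≤-x)) e≤0 ⟩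
      exp (- x) * 0#     ≈⟨ zeroʳ _ ⟩
      0#                 ∎) 1≰0
      where
      0≤-x : 0# ≤ - x
      0≤-x = ≤.trans (x≤y⇒0≤y-x x≤0) (≤.reflexive (+-identityˡ _))

    exp-mono : ∀ {x y} → x ≤ y → exp x ≤ exp y
    exp-mono {x} {y} x≤y = begin
      exp x                      ≈⟨ *-identityʳ _ ⟨
      exp x * 1#                 ≤⟨ *-monoʳ-≤ (exp-nonNeg x) (0≤x⇒1≤exp (x≤y⇒0≤y-x x≤y)) ⟩
      exp x * exp (y + (- x))    ≈⟨ exp-+ x _ ⟨
      exp (x + (y + (- x)))      ≈⟨ exp-cong (y+[x-y]≈x y x) ⟩
      exp y                      ∎

    exp-neg-log : ∀ {x} → 0# < x → exp (- log x) * x ≈ 1#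
    exp-neg-log {x} 0<x = trans (*-congˡ (sym (exp-log x 0<x))) (exp-neg (log x))

    -- From `1 - log x ≤ exp (- log x) = 1 / x ≤ 1`.
    log-nonNeg : ∀ {x} → 1# ≤ x → 0# ≤ log x
    log-nonNeg {x} 1≤x = +-cancelʳ-≤ (1# + (- log x)) (begin
      0# + (1# + (- log x))     ≈⟨ +-identityˡ _ ⟩
      1# + (- log x)            ≤⟨ 1+x≤exp (- log x) ⟩
      exp (- log x)             ≈⟨ *-identityʳ _ ⟨
      exp (- log x) * 1#        ≤⟨ *-monoʳ-≤ (exp-nonNeg _) 1≤x ⟩
      exp (- log x) * x         ≈⟨ exp-neg-log (1≤⇒0< 1≤x) ⟩
      1#                        ≈⟨ y+[x-y]≈x 1# (log x) ⟨
      log x + (1# + (- log x))  ∎)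

    -- From `1 - log x ≤ exp (- log x) = 1 / x ≤ 1 / 2`, doubled to avoid the fraction.
    1≤2log : ∀ {x} → 1# + 1# ≤ x → 1# ≤ log x + log x
    1≤2log {x} 2≤x = +-cancelˡ-≤ 1# (begin
      1# + 1#                                  ≈⟨ +-cong (x-y+y≈x 1# l) (x-y+y≈x 1# l) ⟨
      1# + (- l) + l + (1# + (- l) + l)        ≈⟨ interchange _ l _ l ⟩
      1# + (- l) + (1# + (- l)) + (l + l)      ≤⟨ +-monoˡ-≤ (l + l) (begin
        1# + (- l) + (1# + (- l))                ≤⟨ +-mono-≤ (1+x≤exp (- l)) (1+x≤exp (- l)) ⟩
        exp (- l) + exp (- l)                    ≈⟨ +-cong (*-identityʳ _) (*-identityʳ _) ⟨
        exp (- l) * 1# + exp (- l) * 1#          ≈⟨ distribˡ _ 1# 1# ⟨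
        exp (- l) * (1# + 1#)                    ≤⟨ *-monoʳ-≤ (exp-nonNeg _) 2≤x ⟩
        exp (- l) * x                            ≈⟨ exp-neg-log (1≤⇒0< (≤.trans (x≤y+x 0≤1) 2≤x)) ⟩
        1#                                       ∎) ⟩
      1# + (l + l)                             ∎)
      where
      l = log x

    fromℕ-^-≤ : ∀ {c ℓ} j → fromℕ c ≤ exp ℓ → fromℕ (c ℕ.^ j) ≤ exp (j · ℓ)
    fromℕ-^-≤ {c} {ℓ} zero    c≤ = ≤.reflexive (trans (×-homo-1 1#) (sym exp-0))
    fromℕ-^-≤ {c} {ℓ} (suc j) c≤ = begin
      fromℕ (c ℕ.* c ℕ.^ j)       ≈⟨ ×1-homo-* c (c ℕ.^ j) ⟩
      fromℕ c * fromℕ (c ℕ.^ j)   ≤⟨ *-monoʳ-≤ (·-nonNeg c 0≤1) (fromℕ-^-≤ j c≤) ⟩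
      fromℕ c * exp (j · ℓ)       ≤⟨ *-monoˡ-≤ (exp-nonNeg _) c≤ ⟩
      exp ℓ * exp (j · ℓ)         ≈⟨ exp-+ ℓ (j · ℓ) ⟨
      exp (ℓ + j · ℓ)             ∎

    -- `m ≤ b^(4 ν)`, and `2 log y ≥ 1` turns the exponent `4 ν` into `8 ν log y`.
    power-monotone-bound : ∀ {y b} → 1# + 1# ≤ y → 1# ≤ b → ∀ ν {c m} → fromℕ c ≤ b →
      m ℕ.≤ c ℕ.^ (2 ℕ.* (2 ℕ.* ν)) → fromℕ m ≤ b ^ʳ (fromℕ 8 * fromℕ ν * log y)
    power-monotone-bound {y} {b} 2≤y 1≤b ν {c} {m} c≤b m≤ = begin
      fromℕ m                                  ≤⟨ ·-monoˡ-≤ 0≤1 m≤ ⟩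
      fromℕ (c ℕ.^ k)
        ≤⟨ fromℕ-^-≤ k (≤.trans c≤b (≤.reflexive (sym (exp-log b (1≤⇒0< 1≤b))))) ⟩
      exp (k · log b)                          ≤⟨ exp-mono exponent≤ ⟩
      exp (fromℕ 8 * fromℕ ν * log y * log b)  ∎
      where
      k = 2 ℕ.* (2 ℕ.* ν)
      k+k≡8ν : ∀ ν → 2 ℕ.* (2 ℕ.* ν) ℕ.+ 2 ℕ.* (2 ℕ.* ν) ≡ 8 ℕ.* ν
      k+k≡8ν = solve-∀
      exponent≤ : k · log b ≤ fromℕ 8 * fromℕ ν * log y * log b
      exponent≤ = begin
        k · log b                                ≈⟨ ·≈fromℕ* k (log b) ⟩
        fromℕ k * log b                          ≤⟨ *-monoˡ-≤ (log-nonNeg 1≤b) (begin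
          fromℕ k                                  ≈⟨ *-identityʳ _ ⟨
          fromℕ k * 1#                             ≤⟨ *-monoʳ-≤ (·-nonNeg k 0≤1) (1≤2log 2≤y) ⟩
          fromℕ k * (log y + log y)                ≈⟨ distribˡ _ _ _ ⟩
          fromℕ k * log y + fromℕ k * log y        ≈⟨ distribʳ _ _ _ ⟨
          (fromℕ k + fromℕ k) * log y              ≈⟨ *-congʳ (×-homo-+ 1# k k) ⟨
          fromℕ (k ℕ.+ k) * log y                  ≈⟨ *-congʳ (×-congˡ (k+k≡8ν ν)) ⟩
          fromℕ (8 ℕ.* ν) * log y                  ≈⟨ *-congʳ (×1-homo-* 8 ν) ⟩
          fromℕ 8 * fromℕ ν * log y                ∎) ⟩
        fromℕ 8 * fromℕ ν * log y * log b        ∎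

    1≤power : ∀ {y b} → 1# ≤ y → 1# ≤ b → ∀ k ν → 1# ≤ b ^ʳ (fromℕ k * fromℕ ν * log y)
    1≤power 1≤y 1≤b k ν = 0≤x⇒1≤exp (*-nonNeg
      (*-nonNeg (*-nonNeg (·-nonNeg k 0≤1) (·-nonNeg ν 0≤1)) (log-nonNeg 1≤y)) (log-nonNeg 1≤b))

  1≤fromℕ* : ∀ {y} k → 1# ≤ y → 1# ≤ fromℕ (suc k) * y
  1≤fromℕ* {y} k 1≤y = begin
    1#                ≤⟨ 1≤y ⟩
    y                 ≈⟨ ×-homo-1 y ⟨
    1 · y             ≤⟨ ·-monoˡ-≤ {1} {suc k} (≤.trans 0≤1 1≤y) (s≤s z≤n) ⟩
    suc k · y         ≈⟨ ·≈fromℕ* (suc k) y ⟩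
    fromℕ (suc k) * y ∎

  -- `s ≤ y + 1 ≤ 2 y`: rounding up costs a factor of two.
  fromℕ-*-ceiling : ∀ c {s y} → 1# ≤ y → fromℕ s ≤ y + 1# → fromℕ (c ℕ.* s) ≤ fromℕ (c ℕ.* 2) * y
  fromℕ-*-ceiling c {s} {y} 1≤y s≤y+1 = begin
    fromℕ (c ℕ.* s)      ≈⟨ ×-assocˡ 1# c s ⟨
    c · fromℕ s          ≤⟨ ·-monoʳ-≤ c (≤.trans s≤y+1 (+-monoʳ-≤ y 1≤y)) ⟩
    c · (y + y)          ≈⟨ ×-congʳ c (+-congˡ (×-homo-1 y)) ⟨
    c · (2 · y)          ≈⟨ ×-assocˡ y c 2 ⟩
    (c ℕ.* 2) · y        ≈⟨ ·≈fromℕ* (c ℕ.* 2) y ⟩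
    fromℕ (c ℕ.* 2) * y  ∎

-- Weights of the sets K_S and their centers

module WeightedMIS (R : CompleteOrderedField) {n : ℕ} (G : Graph n)
  (w : MIS G → CompleteOrderedField.ℝ R)
  (0≤w : ∀ I → CompleteOrderedField._≤_ R (CompleteOrderedField.0# R) (w I)) where
  open CompleteOrderedField R
  open OrderedField R
  open WeightedSum (allMIS G) w 0≤w
  open ≤-Reasoning
  open MIS

  -- The weight of `K S`; further below come those of its part containing `v` and of its part
  -- outside `K T`.
  μ : Subset n → ℝ
  μ S = 𝔼 λ I → indicator (S ⊆? vertices I)

  in∩ : Subset n → Fin n → MIS G → ℕ
  in∩ S v I = indicator ((S ⊆? vertices I) ×-dec (v ∈? vertices I))

  in∖ : Subset n → Subset n → MIS G → ℕ
  in∖ S T I = indicator (splits? G I (T , S))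

  μ∩ : Subset n → Fin n → ℝ
  μ∩ S v = 𝔼 (in∩ S v)

  μ∖ : Subset n → Subset n → ℝ
  μ∖ S T = 𝔼 (in∖ S T)

  μ≤total : ∀ S → μ S ≤ total-weight
  μ≤total S = 𝔼-mono λ I → indicator-≤1 (S ⊆? vertices I)

  Heavy : Subset n → Pred (Fin n) 0ℓ
  Heavy S v = ¬ (μ∩ S v + μ∩ S v ≤ μ S)

  heavy? : ∀ S → Decidable (Heavy S)
  heavy? S v = ¬? (μ∩ S v + μ∩ S v ≤? μ S)

  -- No independent set contains both ends of an edge, so adjacent `u` and `v` cut out disjoint
  -- parts of `K S`, and these cannot both have more than half of its weight.
  heavy-independent : ∀ S → IsIndependent G (subset (heavy? S))
  heavy-independent S u v u∈ v∈ u~v = ∈-subset⁻ (heavy? S) u∈ (+-cancelʳ-≤ (μ S) (begin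
    a + a + μ S           ≤⟨ +-monoʳ-≤ (a + a) (≰⇒≥ (∈-subset⁻ (heavy? S) v∈)) ⟩
    a + a + (b + b)      ≈⟨ interchange a a b b ⟩
    (a + b) + (a + b)    ≤⟨ +-mono-≤ disjoint disjoint ⟩
    μ S + μ S              ∎))
    where
    a = μ∩ S u
    b = μ∩ S v
    disjoint : a + b ≤ μ S
    disjoint = begin
      a + b                           ≈⟨ 𝔼-+ (in∩ S u) (in∩ S v) ⟨
      𝔼 (λ I → in∩ S u I ℕ.+ in∩ S v I) ≤⟨ 𝔼-mono (λ I → indicator-disjoint
                  ((S ⊆? vertices I) ×-dec (u ∈? vertices I)) ((S ⊆? vertices I) ×-dec (v ∈? vertices I))
                  (S ⊆? vertices I) proj₁ proj₁
                  λ (_ , u∈I) (_ , v∈I) → proj₁ (maximalIndependent G I) u v u∈I v∈I u~v) ⟩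
      μ S    ∎

  -- Abstract, so that with-abstraction does not unfold the search for a maximal set.
  abstract
    center : Subset n → MIS G
    center S = proj₁ (extend G (subset (heavy? S)) (heavy-independent S))

    heavy⇒∈center : ∀ {S v} → Heavy S v → v ∈ vertices (center S)
    heavy⇒∈center {S} heavy =
      proj₂ (extend G (subset (heavy? S)) (heavy-independent S)) (∈-subset⁺ (heavy? S) heavy)

  -- All heavy vertices lie in the center, so a vertex of `T` outside it is not heavy.
  center-miss : ∀ {S T} → ¬ T ⊆ vertices (center S) →
    ∃ λ v → v ∈ T × v ∉ vertices (center S) × μ∩ S v + μ∩ S v ≤ μ S
  center-miss {S} {T} T⊈ with ⊈⇒∃ T⊈
  ... | v , v∈T , v∉ = v , v∈T , v∉ , decidable-stable (μ∩ S v + μ∩ S v ≤? μ S) λ heavy →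
    v∉ (heavy⇒∈center heavy)

  -- As `v` lies in `T`, the set `K S` is covered by its points containing `v` and its points
  -- outside `K T`; the first part has at most half of the weight.
  center-miss-half : ∀ {S T} → ¬ T ⊆ vertices (center S) → μ S ≤ 2 · μ∖ S T
  center-miss-half {S} {T} T⊈ with center-miss T⊈
  ... | v , v∈T , _ , light = +-cancelˡ-≤ (μ S) (begin
    μ S + μ S                                    ≤⟨ +-mono-≤ union union ⟩
    (μ∩ S v + μ∖ S T) + (μ∩ S v + μ∖ S T)      ≈⟨ interchange (μ∩ S v) (μ∖ S T) (μ∩ S v) (μ∖ S T) ⟩
    (μ∩ S v + μ∩ S v) + (μ∖ S T + μ∖ S T)      ≤⟨ +-monoˡ-≤ (μ∖ S T + μ∖ S T) light ⟩
    μ S + (μ∖ S T + μ∖ S T)                     ≈⟨ +-congˡ (+-congˡ (×-homo-1 _)) ⟨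
    μ S + 2 · μ∖ S T                             ∎)
    where
    split : ∀ I → S ⊆ vertices I →
            (S ⊆ vertices I × v ∈ vertices I) ⊎ Splits G I (T , S)
    split I S⊆I with v ∈? vertices I
    ... | yes v∈I = inj₁ (S⊆I , v∈I)
    ... | no v∉I  = inj₂ (S⊆I , λ T⊆I → v∉I (T⊆I v∈T))
    union : μ S ≤ μ∩ S v + μ∖ S T
    union = begin
      μ S ≤⟨ 𝔼-mono (λ I → indicator-union (S ⊆? vertices I)
               ((S ⊆? vertices I) ×-dec (v ∈? vertices I)) (splits? G I (T , S)) (split I)) ⟩
      𝔼 (λ I → in∩ S v I ℕ.+ in∖ S T I) ≈⟨ 𝔼-+ (in∩ S v) (in∖ S T) ⟩
      μ∩ S v + μ∖ S T ∎

  -- Greedy nets and their length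

  module _ (ε : ℝ) (0<ε : 0# < ε) where

    IsNet : List (MIS G) → Set
    IsNet ps = ∀ T → ε ≤ μ T → Any (λ p → T ⊆ vertices p) ps

    -- Half of the weight of `K S` is recorded only as `ε / 2`, a bound uniform in `S`. The first
    -- argument is the set added later, since new sets go to the head of the list.
    Separated : Subset n → Subset n → Set
    Separated T S = ε ≤ 2 · μ∖ S T

    -- One pass over all vertex sets, adding `T` whenever `K T` has weight at least `ε` and contains
    -- none of the centers so far.
    greedy-net : ∃ λ Ss → AllPairs Separated Ss × IsNet (map center Ss)
    greedy-net with go (allSubsets n)
      where
      go : ∀ Cs → ∃ λ Ss → AllPairs Separated Ss × All (λ S → ε ≤ μ S) Ss ×
                  All (λ T → ε ≤ μ T → Any (λ p → T ⊆ vertices p) (map center Ss)) Cs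
      go []       = [] , [] , [] , []
      go (T ∷ Cs) with go Cs
      ... | Ss , sep , big , net with ε ≤? μ T | Any.any? (λ p → T ⊆? vertices p) (map center Ss)
      ...   | no small | _        = Ss , sep , big , (λ h → contradiction h small) ∷ net
      ...   | yes _    | yes hit  = Ss , sep , big , (λ _ → hit) ∷ net
      ...   | yes ε≤μT | no ¬hit  = T ∷ Ss ,
        All.zipWith (λ (ε≤μS , T⊈) → ≤.trans ε≤μS (center-miss-half T⊈))
                    (big , All.map⁻ (All.¬Any⇒All¬ _ ¬hit)) ∷ sep ,
        ε≤μT ∷ big ,
        (λ _ → here center-self) ∷ All.map (there ∘_) net
        where
        -- Every point of `K T` contains each `v` in `T`, so a light such `v` would give
        -- `2 μ T ≤ μ T`, against `μ T ≥ ε > 0`.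
        center-self : T ⊆ vertices (center T)
        center-self with T ⊆? vertices (center T)
        ... | yes T⊆ = T⊆
        ... | no T⊈ with center-miss T⊈
        ...   | v , v∈T , _ , light = contradiction (≤.antisym (proj₁ 0<ε) (+-cancelʳ-≤ (μ T) (begin
          ε + μ T             ≤⟨ +-monoˡ-≤ (μ T) ε≤μT ⟩
          μ T + μ T           ≤⟨ +-mono-≤ μT≤ μT≤ ⟩
          μ∩ T v + μ∩ T v     ≤⟨ light ⟩
          μ T                  ≈⟨ +-identityˡ _ ⟨
          0# + μ T            ∎))) (proj₂ 0<ε)
          where
          μT≤ : μ T ≤ μ∩ T v
          μT≤ = 𝔼-mono λ I → indicator-mono (T ⊆? vertices I)
            ((T ⊆? vertices I) ×-dec (v ∈? vertices I)) λ T⊆I → T⊆I , T⊆I v∈T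
    ... | Ss , sep , _ , net = Ss , sep , λ T → All.lookup net (∈-allSubsets T)

    -- `y` is the total weight in units of `ε`: it is `1 / ε` for a probability measure, and `τ*`
    -- for an optimal fractional transversal with `ε = 1`.
    module _ (y : ℝ) (total≈ : total-weight ≈ y * ε) where

      positive-total : 1# ≤ y → 0# < total-weight
      positive-total 1≤y = ≤.trans (proj₁ 0<ε) ε≤W , λ 0≈W →
        proj₂ 0<ε (≤.antisym (proj₁ 0<ε) (≤.trans ε≤W (≤.reflexive (sym 0≈W))))
        where
        ε≤W : ε ≤ total-weight
        ε≤W = begin
          ε              ≈⟨ *-identityˡ ε ⟨
          1# * ε        ≤⟨ *-monoˡ-≤ (proj₁ 0<ε) 1≤y ⟩
          y * ε         ≈⟨ total≈ ⟨
          total-weight   ∎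

      empty-net : ¬ (1# ≤ y) → IsNet []
      empty-net 1≰y T ε≤μT = contradiction (*-cancelʳ-≤-pos 0<ε (begin
        1# * ε        ≈⟨ *-identityˡ ε ⟩
        ε              ≤⟨ ε≤μT ⟩
        μ T            ≤⟨ μ≤total T ⟩
        total-weight   ≈⟨ total≈ ⟩
        y * ε         ∎)) 1≰y

      -- If `K T` misses the center of the empty set, some `v` in `T` lies in at most half of the
      -- total weight, so `2 ε ≤ y ε`.
      singleton-net-above-half : ¬ (1# + 1# ≤ y) → IsNet (center ⊥ ∷ [])
      singleton-net-above-half 2≰y T ε≤μT with T ⊆? vertices (center ⊥)
      ... | yes T⊆ = here T⊆
      ... | no T⊈ with center-miss T⊈
      ...   | v , v∈T , _ , light = contradiction (*-cancelʳ-≤-pos 0<ε (begin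
        (1# + 1#) * ε        ≈⟨ distribʳ ε 1# 1# ⟩
        1# * ε + 1# * ε     ≈⟨ +-cong (*-identityˡ ε) (*-identityˡ ε) ⟩
        ε + ε                 ≤⟨ +-mono-≤ ε≤μ∩ ε≤μ∩ ⟩
        μ∩ ⊥ v + μ∩ ⊥ v       ≤⟨ light ⟩
        μ ⊥                    ≤⟨ μ≤total ⊥ ⟩
        total-weight           ≈⟨ total≈ ⟩
        y * ε                 ∎)) 2≰y
        where
        ε≤μ∩ : ε ≤ μ∩ ⊥ v
        ε≤μ∩ = ≤.trans ε≤μT (𝔼-mono λ I → indicator-mono (T ⊆? vertices I)
          ((⊥ ⊆? vertices I) ×-dec (v ∈? vertices I)) λ T⊆I → ⊆-min (vertices I) , T⊆I v∈T)

      -- A separated pair is split by weight at least `ε / 2`, which is at least `1 / (2 s)` of the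
      -- total `y ε` because `y ≤ s`. This is the `r = 2 s` in `q = 15 r`.
      greedy-net-bound : ∀ {ν} → Isν-bi G ν → 1 ℕ.≤ ν → 1# ≤ y →
        ∀ {Ss} → AllPairs Separated Ss → ∀ s q → y ≤ fromℕ s → q ≡ 15 ℕ.* (s ℕ.* 2) →
        length Ss ℕ.≤ (4 ℕ.* q) ℕ.^ (2 ℕ.* (2 ℕ.* ν))
      greedy-net-bound ν-bi 1≤ν 1≤y sep zero    q y≤0 _ =
        contradiction (≤.trans 1≤y y≤0) 1≰0
      greedy-net-bound ν-bi 1≤ν 1≤y sep s@(suc _) q y≤s q≡ =
        separated-length-bound G ν-bi 1≤ν Separated q (s ℕ.* 2) {{q≢0}} q≡ (s≤s z≤n) popular sep
        where
        q≢0 : NonZero q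
        q≢0 = ≡.subst NonZero (≡.sym q≡) _
        popular : ∀ ps → All (uncurry Separated) ps →
          ∃ λ I → length ps ℕ.≤ s ℕ.* 2 ℕ.* length (filter (splits? G I) ps)
        popular ps sep = popular-point (splits? G) (s ℕ.* 2) ps (positive-total 1≤y)
          (All.map (λ {p} → often p) sep)
          where
          often : ∀ p → uncurry Separated p →
                  total-weight ≤ (s ℕ.* 2) · 𝔼 (λ I → indicator (splits? G I p))
          often (T , S) ε≤ = begin
            total-weight             ≈⟨ total≈ ⟩
            y * ε                   ≤⟨ *-monoˡ-≤ (proj₁ 0<ε) y≤s ⟩
            fromℕ s * ε             ≈⟨ ·≈fromℕ* s ε ⟨
            s · ε                    ≤⟨ ·-monoʳ-≤ s ε≤ ⟩
            s · (2 · μ∖ S T)         ≈⟨ ×-assocˡ (μ∖ S T) s 2 ⟩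
            (s ℕ.* 2) · μ∖ S T         ∎

  -- An edge is a bimatching of size 1, so there is none; by maximality the center then contains
  -- every vertex.
  edgeless-net : Isν-bi G 0 → ∀ {ε} (0<ε : 0# < ε) → IsNet ε 0<ε (center ⊥ ∷ [])
  edgeless-net (_ , max) _ T _ with T ⊆? vertices (center ⊥)
  ... | yes T⊆ = here T⊆
  ... | no T⊈ with center-miss T⊈
  ...   | v , _ , v∉ , _ with neighbour G (center ⊥) v∉
  ...     | _ , _ , u~v with max 1 (edge⇒bimatching G u~v)
  ...       | ()

-- Assembling the size bound

module _ (R : CompleteOrderedField) (E : NaturalExpLog R) {n : ℕ} (G : Graph n)
  {ν : ℕ} (ν-bi : Isν-bi G ν) where
  open CompleteOrderedField R
  open NaturalExpLog E
  open OrderedField R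
  open Exponential E
  open ≤-Reasoning

  sizeBound : ℝ → ℝ
  sizeBound y = (fromℕ 480 * y) ^ʳ (fromℕ 8 * fromℕ ν * log y)

  1≤sizeBound : ∀ {y} → 1# ≤ y → fromℕ 1 ≤ sizeBound y
  1≤sizeBound 1≤y = ≤.trans (≤.reflexive (×-homo-1 1#)) (1≤power 1≤y (1≤fromℕ* 479 1≤y) 8 ν)

  -- The goal is a decidable inequality, hence stable under double negation, which lets
  -- `archimedean` provide the ceiling `s` of `y`.
  length-≤-sizeBound : ∀ {y} → 1# + 1# ≤ y → ∀ {m} →
    (∀ s q → y ≤ fromℕ s → q ≡ 15 ℕ.* (s ℕ.* 2) → m ℕ.≤ (4 ℕ.* q) ℕ.^ (2 ℕ.* (2 ℕ.* ν))) →
    fromℕ m ≤ sizeBound y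
  length-≤-sizeBound {y} 2≤y {m} m≤ = decidable-stable (fromℕ m ≤? sizeBound y) λ ¬bound →
    archimedean y λ (s₀ , y≤s₀) → ¬bound (bound (ceiling (≤.trans 0≤1 1≤y) s₀ y≤s₀))
    where
    1≤y : 1# ≤ y
    1≤y = ≤.trans (x≤y+x 0≤1) 2≤y
    120s : ∀ s → 4 ℕ.* (15 ℕ.* (s ℕ.* 2)) ≡ 120 ℕ.* s
    120s = solve-∀
    bound : (∃ λ s → y ≤ fromℕ s × fromℕ s ≤ y + 1#) → fromℕ m ≤ sizeBound y
    bound (s , y≤s , s≤y+1) =
      power-monotone-bound 2≤y (1≤fromℕ* 479 1≤y) ν base≤ (m≤ s _ y≤s ≡.refl)
      where
      -- The base is `4 q = 120 s ≤ 240 s ≤ 480 y`; passing from 120 to 240 is slack that reaches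
      -- the stated constant.
      base≤ : fromℕ (4 ℕ.* (15 ℕ.* (s ℕ.* 2))) ≤ fromℕ 480 * y
      base≤ = begin
        fromℕ (4 ℕ.* (15 ℕ.* (s ℕ.* 2)))  ≈⟨ ×-congˡ (120s s) ⟩
        fromℕ (120 ℕ.* s)
          ≤⟨ ·-monoˡ-≤ {120 ℕ.* s} {240 ℕ.* s} 0≤1 (ℕ.*-monoˡ-≤ s (ℕ.m≤m+n 120 120)) ⟩
        fromℕ (240 ℕ.* s)                 ≤⟨ fromℕ-*-ceiling 240 {s} 1≤y s≤y+1 ⟩
        fromℕ 480 * y                     ∎

  module _ (w : MIS G → ℝ) (0≤w : ∀ I → 0# ≤ w I) where
    open WeightedMIS R G w 0≤w
    open WeightedSum (allMIS G) w 0≤w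

    weighted-net : ∀ {ε} (0<ε : 0# < ε) y → total R G w ≈ y * ε →
      ∃ λ ps → IsNet ε 0<ε ps × fromℕ (length ps) ≤ sizeBound y
    weighted-net {ε} 0<ε y total≈ = cases (1# ≤? y) (1# + 1# ≤? y) (1 ℕ.≤? ν)
      where
      W≈ : total-weight ≈ y * ε
      W≈ = trans total-weight≈ total≈
      cases : Dec (1# ≤ y) → Dec (1# + 1# ≤ y) → Dec (1 ℕ.≤ ν) →
              ∃ λ ps → IsNet ε 0<ε ps × fromℕ (length ps) ≤ sizeBound y
      -- The bound is an exponential, hence non-negative whatever value `log` takes here, and the
      -- empty net has size 0.
      cases (no 1≰y)  _         _        =
        [] , empty-net ε 0<ε y W≈ 1≰y ,
        exp-nonNeg (fromℕ 8 * fromℕ ν * log y * log (fromℕ 480 * y))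
      -- The exponent may be arbitrarily small for `y` near 1, so the net must be a single point.
      cases (yes 1≤y) (no 2≰y)  _        =
        center ⊥ ∷ [] , singleton-net-above-half ε 0<ε y W≈ 2≰y , 1≤sizeBound 1≤y
      -- With `ν = 0` the exponent vanishes, so again only a single point is allowed.
      cases (yes 1≤y) (yes _)   (no 1≰ν) =
        center ⊥ ∷ [] ,
        edgeless-net (≡.subst (Isν-bi G) (ℕ.n<1⇒n≡0 (ℕ.≰⇒> 1≰ν)) ν-bi) 0<ε ,
        1≤sizeBound 1≤y
      cases (yes 1≤y) (yes 2≤y) (yes 1≤ν) with greedy-net ε 0<ε
      ... | Ss , sep , net = map center Ss , net ,
        ≡.subst (λ m → fromℕ m ≤ sizeBound y) (≡.sym (length-map center Ss))
          (length-≤-sizeBound 2≤y (greedy-net-bound ε 0<ε y W≈ ν-bi 1≤ν 1≤y sep))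

    net-set : ∀ {ε} (0<ε : 0# < ε) y → total R G w ≈ y * ε →
      ∃ λ N → (∀ C → 𝒞 G C → ε ≤ sumOn R G C w → Meets G N C) × fromℕ (card G N) ≤ sizeBound y
    net-set {ε} 0<ε y total≈ with weighted-net 0<ε y total≈
    ... | ps , net , small = setOf G ps , meets ,
      ≤.trans (·-monoˡ-≤ 0≤1 (card-setOf G ps)) small
      where
      meets : ∀ C → 𝒞 G C → ε ≤ sumOn R G C w → Meets G (setOf G ps) C
      meets C (S , C≡K) ε≤ with find (net S (≤.trans ε≤
          (≤.reflexive (𝔼-indicator C (λ I → S ⊆? MIS.vertices I) C≡K))))
      ... | p , p∈ps , S⊆p = p , setOf-∈ G p∈ps , ≡.trans (C≡K p) (K-true G {S} {p} S⊆p)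

theorem2p28 : (R : CompleteOrderedField) (E : NaturalExpLog R) →
    let open CompleteOrderedField R
        open NaturalExpLog E in
    {n : ℕ} (G : Graph n) (ν : ℕ) → Isν-bi G ν →
    (∀ ε → 0# < ε →
      HasWeakNetsOfSize≤ R G ε
        ((fromℕ 480 * ε ⁻¹) ^ʳ (fromℕ 8 * fromℕ ν * log (ε ⁻¹))))
    ×
    (∀ (𝒢 : SetSystem G) → 𝒢 Unary.⊆ 𝒞 G → ∀ t τ* → IsTau G 𝒢 t → IsTau* R G 𝒢 τ* →
      fromℕ t ≤ (fromℕ 480 * τ*) ^ʳ (fromℕ 8 * fromℕ ν * log τ*))
theorem2p28 R E G ν ν-bi = weak-nets , tau-bound
  where
  open CompleteOrderedField R
  open OrderedField R
  open Exponential E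

  weak-nets : ∀ ε → 0# < ε → HasWeakNetsOfSize≤ R G ε (sizeBound R E G ν-bi (ε ⁻¹))
  weak-nets ε 0<ε μ = net-set R E G ν-bi weight weight-nonNeg 0<ε (ε ⁻¹)
    (trans weight-total (sym (trans (*-comm (ε ⁻¹) ε) (⁻¹-inverseʳ ε λ ε≈0 → proj₂ 0<ε (sym ε≈0)))))
    where open ProbabilityMeasure μ

  tau-bound : ∀ (𝒢 : SetSystem G) → 𝒢 Unary.⊆ 𝒞 G → ∀ t τ* → IsTau G 𝒢 t → IsTau* R G 𝒢 τ* →
              fromℕ t ≤ sizeBound R E G ν-bi τ*
  -- An optimal fractional transversal serves as the weights, with `ε = 1`. Every member of `𝒢` then
  -- has weight at least 1, so the net is a transversal of `𝒢`.
  tau-bound 𝒢 𝒢⊆𝒞 t τ* (_ , minimal) ((f , (f-range , f-covers) , total≈τ*) , _)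
    with net-set R E G ν-bi f (proj₁ ∘ f-range) (1≤⇒0< ≤.refl) τ*
           (trans total≈τ* (sym (*-identityʳ τ*)))
  ... | N , meets , small = ≤.trans
    (·-monoˡ-≤ 0≤1 (minimal N λ A A∈𝒢 → meets A (𝒢⊆𝒞 A∈𝒢) (f-covers A A∈𝒢))) small
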